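{- Let $k \in \{2,3\}$. For each $n$, let $L = L_n$ be the set of eigenvalues of the complete $k$-uniform hypergraph $K_n^{(k)}$ on $n$ vertices (that is, of its adjacency hypermatrix), and let $M = M_n$ be the set of eigenvalues of $\frac{1}{(k-1)!}\mathbb{J}_n^k$, where $\mathbb{J}_n^k$ is the all-ones hypermatrix of order $k$ and dimension $n$. Then, as $n \to \infty$, $$\delta(M_n, L_n) = o(n^{k-1}),$$ where $\delta$ denotes the Minkowski distance between subsets of $\mathbb{C}$.
   Context: A (cubical) hypermatrix of order $k$ and dimension $n$ is an array $A = [a_{i_1\cdots i_k}]$ with indices in $[n]=\{1,\ldots,n\}$. $\mathbb{J}_n^k$ is the order $k$, dimension $n$ hypermatrix all of whose entries are $1$. The adjacency hypermatrix of a $k$-uniform hypergraph $H$ on vertex set $[n]$ with edge set $E(H)$ is the order $k$, dimension $n$ hypermatrix whose $(i_1,\ldots,i_k)$ entry is $\frac{1}{(k-1)!}$ if $\{i_1,\ldots,i_k\}\in E(H)$ and $0$ otherwise (in particular it is $0$ whenever some index is repeated). The complete $k$-uniform hypergraph $K_n^{(k)}$ has as edges all $k$-element subsets of $[n]$. For a symmetric hypermatrix $A$ (entries invariant under permutation of the indices) of order $k$ and dimension $n$, a complex number $\lambda$ is an eigenvalue of $A$ if there is a nonzero $\mathbf{v}\in\mathbb{C}^n$ such that, for every $i\in[n]$, $$\sum_{i_2,\ldots,i_k=1}^n a_{i i_2\cdots i_k}v_{i_2}\cdots v_{i_k} = \lambda v_i^{k-1}.$$ For $A,B\subset\mathbb{C}$,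 the Minkowski distance is $\delta(A,B)=\inf\{r : A\subset\mathcal{N}_r(B)\text{ and }B\subset\mathcal{N}_r(A)\}$, where $\mathcal{N}_r(S)=\bigcup_{z\in S}B_r(z)$ and $B_r(z)=\{w\in\mathbb{C}: |z-w|<r\}$. -}

module Defs where

open import Algebra.Bundles using (CommutativeRing; CommutativeSemiring; RawRing)
open import Algebra.Core using (Op₁; Op₂)
import Algebra.Definitions.RawSemiring as RawSemiringDefinitions
import Algebra.Properties.Ring as RingProperties
import Algebra.Solver.Ring.NaturalCoefficients.Default as Solver
open import Algebra.Structures using (IsCommutativeRing)
open import Data.Bool.Base using (if_then_else_)
open import Data.Empty using (⊥-elim)
open import Data.Fin.Base using (Fin)
open import Data.Fin.Subset using (Subset; ⁅_⁆; ⋃) renaming (∣_∣ to card)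
import Data.List.Base as List
import Data.Nat.Base as ℕ
open ℕ using (ℕ; zero; suc)
import Data.Nat.Properties as ℕₚ
open import Data.Product.Base using (∃; _×_; _,_; proj₁; proj₂)
open import Data.Sum.Base using (inj₁; inj₂)
open import Data.Vec.Base as Vec using (Vec; []; _∷_; toList)
open import Data.Vec.Functional using (Vector)
open import Function.Base using (id)
open import Level using (0ℓ)
open import Relation.Binary.Core using (Rel)
open import Relation.Binary.Definitions using (tri<; tri≈; tri>)
open import Relation.Binary.PropositionalEquality using (_≡_)
open import Relation.Binary.Structures using (IsStrictTotalOrder)
import Relation.Binary.Reasoning.Setoid as ≈-Reasoning
import Relation.Binary.Construct.StrictToNonStrict as StrictToNonStrict
open import Relation.Nullary using (¬_; does)
open import Relation.Unary using (Pred; Decidable; _⊆_)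

module Bounds {A : Set} (_≤_ : Rel A 0ℓ) where

  UpperBound LowerBound : Pred A 0ℓ → Pred A 0ℓ
  UpperBound P u = ∀ {x} → P x → x ≤ u
  LowerBound P l = ∀ {x} → P x → l ≤ x

  record IsSupremum (P : Pred A 0ℓ) (s : A) : Set where
    field
      upper : UpperBound P s
      least : ∀ {u} → UpperBound P u → s ≤ u

  record IsInfimum (P : Pred A 0ℓ) (s : A) : Set where
    field
      lower    : LowerBound P s
      greatest : ∀ {l} → LowerBound P l → l ≤ s

-- The real numbers are axiomatised, classically, as a Dedekind-complete
-- ordered field; this determines them up to isomorphism.

record CompleteOrderedField : Set₁ where
  infix  4 _≈_ _<_
  infixl 6 _+_
  infixl 7 _*_
  infix  8 -_
  infix  9 _⁻¹
  field
    Carrier : Set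
    _≈_ _<_ : Rel Carrier 0ℓ
    _+_ _*_ : Op₂ Carrier
    -_      : Op₁ Carrier
    0# 1#   : Carrier
    -- Total, as is usual in type theory: the value at 0# is unspecified.
    _⁻¹     : Op₁ Carrier

    isCommutativeRing  : IsCommutativeRing _≈_ _+_ _*_ -_ 0# 1#
    isStrictTotalOrder : IsStrictTotalOrder _≈_ _<_
    ⁻¹-cong     : ∀ {x y} → x ≈ y → x ⁻¹ ≈ y ⁻¹
    *-inverseʳ  : ∀ x → ¬ x ≈ 0# → x * x ⁻¹ ≈ 1#
    0<1         : 0# < 1#
    +-monoʳ-<   : ∀ x {y z} → y < z → x + y < x + z
    *-pos       : ∀ {x y} → 0# < x → 0# < y → 0# < x * y

  open StrictToNonStrict _≈_ _<_ public using (_≤_)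
  open Bounds _≤_ public

  commutativeRing : CommutativeRing 0ℓ 0ℓ
  commutativeRing = record { isCommutativeRing = isCommutativeRing }

  private
    module R = CommutativeRing commutativeRing
    module O = IsStrictTotalOrder isStrictTotalOrder

  open RawSemiringDefinitions (CommutativeSemiring.rawSemiring R.commutativeSemiring)
    public using () renaming (_×_ to _×ℝ_)

  fromℕ : ℕ → Carrier
  fromℕ n = n ×ℝ 1#

  field
    supremum : (P : Pred Carrier 0ℓ) → ∃ P → ∃ (UpperBound P) →
               ∃ (IsSupremum P)
    -- Classically a consequence of supremum, which constructively only
    -- yields that no x bounds every natural number.
    archimedean : ∀ x → ∃ λ n → x < fromℕ n

  private
    open RingProperties R.ring using (+-cancelʳ; -‿distribˡ-*; -‿distribʳ-*; -‿involutive)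
    open ≈-Reasoning R.setoid
    open Solver R.commutativeSemiring using (solve; con; _:+_; _:*_; _:=_)
    module N = StrictToNonStrict _≈_ _<_

  <-resp₂ : ∀ {a b c d} → a ≈ b → c ≈ d → a < c → b < d
  <-resp₂ p q r = proj₂ O.<-resp-≈ p (proj₁ O.<-resp-≈ q r)

  ≤-resp₂ : ∀ {a b c d} → a ≈ b → c ≈ d → a ≤ c → b ≤ d
  ≤-resp₂ p q (inj₁ r) = inj₁ (<-resp₂ p q r)
  ≤-resp₂ p q (inj₂ r) = inj₂ (R.trans (R.sym p) (R.trans r q))

  <-≤-trans : ∀ {a b c} → a < b → b ≤ c → a < c
  <-≤-trans = N.<-≤-trans O.trans (proj₁ O.<-resp-≈)

  ≤-<-trans : ∀ {a b c} → a ≤ b → b < c → a < c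
  ≤-<-trans = N.≤-<-trans R.sym O.trans (proj₂ O.<-resp-≈)

  <⇒≱ : ∀ {a b} → a < b → ¬ b ≤ a
  <⇒≱ p q = O.irrefl R.refl (<-≤-trans p q)

  ≮⇒≤ : ∀ {a b} → ¬ b < a → a ≤ b
  ≮⇒≤ {a} {b} h with O.compare a b
  ... | tri< p _ _ = inj₁ p
  ... | tri≈ _ p _ = inj₂ p
  ... | tri> _ _ p = ⊥-elim (h p)

  x<x+p : ∀ x {p} → 0# < p → x < x + p
  x<x+p x 0<p = <-resp₂ (R.+-identityʳ x) R.refl (+-monoʳ-< x 0<p)

  x≤x+p : ∀ x {p} → 0# ≤ p → x ≤ x + p
  x≤x+p x (inj₁ 0<p) = inj₁ (x<x+p x 0<p)
  x≤x+p x (inj₂ 0≈p) = inj₂ (R.trans (R.sym (R.+-identityʳ x)) (R.+-congˡ 0≈p))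

  gap : ∀ {a b} → a < b → ∃ λ e → 0# < e × b ≈ a + e
  gap {a} {b} a<b = - a + b , <-resp₂ (R.-‿inverseˡ a) R.refl (+-monoʳ-< (- a) a<b) ,
    R.sym (R.trans (R.sym (R.+-assoc a (- a) b))
                   (R.trans (R.+-congʳ (R.-‿inverseʳ a)) (R.+-identityˡ b)))

  +-pos : ∀ {a b} → 0# < a → 0# < b → 0# < a + b
  +-pos p q = O.trans p (x<x+p _ q)

  +-nonneg : ∀ {a b} → 0# ≤ a → 0# ≤ b → 0# ≤ a + b
  +-nonneg p q = N.trans R.isEquivalence O.<-resp-≈ O.trans p (x≤x+p _ q)

  *-nonneg : ∀ {a b} → 0# ≤ a → 0# ≤ b → 0# ≤ a * b
  *-nonneg (inj₁ p) (inj₁ q) = inj₁ (*-pos p q)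
  *-nonneg (inj₂ p) _        = inj₂ (R.sym (R.trans (R.*-congʳ (R.sym p)) (R.zeroˡ _)))
  *-nonneg (inj₁ _) (inj₂ q) = inj₂ (R.sym (R.trans (R.*-congˡ (R.sym q)) (R.zeroʳ _)))

  pos-cancelˡ : ∀ {a b} → 0# < a → 0# < a * b → 0# < b
  pos-cancelˡ {a} {b} 0<a 0<ab with O.compare 0# b
  ... | tri< p _ _ = p
  ... | tri≈ _ p _ = ⊥-elim (O.irrefl (R.sym (R.trans (R.*-congˡ (R.sym p)) (R.zeroʳ a))) 0<ab)
  ... | tri> _ _ p with e , 0<e , 0≈b+e ← gap p =
    ⊥-elim (<⇒≱ (O.trans 0<ab (x<x+p (a * b) (*-pos 0<a 0<e)))
             (inj₂ (R.trans (R.sym (R.distribˡ a b e))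
                     (R.trans (R.*-congˡ (R.sym 0≈b+e)) (R.zeroʳ a)))))

  square-< : ∀ {a b} → 0# ≤ a → a < b → a * a < b * b
  square-< {a} 0≤a a<b with e , 0<e , b≈ ← gap a<b =
    <-resp₂ R.refl
      (R.trans (solve 2 (λ a e → a :* a :+ (a :* e :+ a :* e :+ e :* e) := (a :+ e) :* (a :+ e))
                       R.refl a e)
             (R.sym (R.*-cong b≈ b≈)))
      (x<x+p (a * a) (≤-<-trans (+-nonneg 0≤ae 0≤ae)
        (x<x+p _ (*-pos 0<e 0<e))))
    where 0≤ae = *-nonneg 0≤a (inj₁ 0<e)

  divide : ∀ {p} q → 0# < p → 0# < q → ∃ λ d → 0# < d × p * d ≈ q
  divide {p} q 0<p 0<q = q * p ⁻¹ , *-pos 0<q 0<p⁻¹ ,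
    R.trans (solve 3 (λ p q i → p :* (q :* i) := q :* (p :* i)) R.refl p q (p ⁻¹))
          (R.trans (R.*-congˡ pp⁻¹≈1) (R.*-identityʳ q))
    where
    pp⁻¹≈1 = *-inverseʳ p (λ p≈0 → O.irrefl (R.sym p≈0) 0<p)
    0<p⁻¹  = pos-cancelˡ 0<p (<-resp₂ R.refl (R.sym pp⁻¹≈1) 0<1)

  raise : ∀ {s x} → 0# ≤ s → s * s < x → ∃ λ t → s < t × t * t ≤ x
  raise {s} {x} 0≤s s²<x =
    let e , 0<e , x≈s²+e = gap s²<x
        0≤2s+e           = +-nonneg (+-nonneg 0≤s 0≤s) (inj₁ 0<e)
        d , 0<d , Dd≈e   = divide e (<-≤-trans 0<1 (x≤x+p 1# 0≤2s+e)) 0<e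
        0≤r              = *-nonneg 0≤2s+e (inj₁ 0<d)
    in s + d , x<x+p s 0<d ,
       ≤-resp₂ R.refl (identity e d x≈s²+e Dd≈e)
         (x≤x+p _ (+-nonneg (inj₁ 0<d) (*-nonneg 0≤r (inj₁ 0<d))))
    where
    identity : ∀ e d → x ≈ s * s + e → (1# + (s + s + e)) * d ≈ e →
               (s + d) * (s + d) + (d + (s + s + e) * d * d) ≈ x
    identity e d x≈s²+e Dd≈e = begin
      (s + d) * (s + d) + (d + r * d)
        ≈⟨ solve 3 (λ s d r → (s :+ d) :* (s :+ d) :+ (d :+ r :* d)
                        := s :* s :+ (d :+ (s :+ s :+ (d :+ r)) :* d)) R.refl s d r ⟩
      s * s + (d + (s + s + (d + r)) * d)
        ≈⟨ R.+-congˡ (R.+-congˡ (R.*-congʳ (R.+-congˡ (R.sym e≈d+r)))) ⟩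
      s * s + (d + (s + s + e) * d) ≈⟨ R.+-congˡ (R.sym e≈d+r) ⟩
      s * s + e                      ≈⟨ R.sym x≈s²+e ⟩
      x                              ∎
      where
      r = (s + s + e) * d
      e≈d+r : e ≈ d + r
      e≈d+r = R.trans (R.sym Dd≈e)
        (R.trans (R.distribʳ d 1# (s + s + e)) (R.+-congʳ (R.*-identityˡ d)))

  lower : ∀ {s x} → 0# < s → 0# ≤ x → x < s * s → ∃ λ t → 0# < t × t < s × x ≤ t * t
  lower {s} {x} 0<s 0≤x x<s² =
    let e , 0<e , s²≈x+e = gap x<s²
        d , 0<d , 2sd≈e  = divide e (+-pos 0<s 0<s) 0<e
        u                = s + - d
        u+d≈s            = R.trans (R.+-assoc s (- d) d)
                             (R.trans (R.+-congˡ (R.-‿inverseˡ d)) (R.+-identityʳ s))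
    in u
     , pos-cancelˡ (+-pos 0<s 0<s)
         (<-resp₂ R.refl (R.sym (2su≈s²+x e d u s²≈x+e 2sd≈e u+d≈s))
           (<-≤-trans (*-pos 0<s 0<s) (x≤x+p (s * s) 0≤x)))
     , <-resp₂ R.refl u+d≈s (x<x+p u 0<d)
     , ≤-resp₂ R.refl (R.sym (u²≈x+d² e d u s²≈x+e 2sd≈e u+d≈s))
         (x≤x+p x (inj₁ (*-pos 0<d 0<d)))
    where
    2su≈s²+x : ∀ e d u → s * s ≈ x + e → (s + s) * d ≈ e → u + d ≈ s →
               (s + s) * u ≈ s * s + x
    2su≈s²+x e d u s²≈x+e 2sd≈e u+d≈s = +-cancelʳ e _ _ (begin
      (s + s) * u + e           ≈⟨ R.+-congˡ (R.sym 2sd≈e) ⟩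
      (s + s) * u + (s + s) * d ≈⟨ R.sym (R.distribˡ (s + s) u d) ⟩
      (s + s) * (u + d)         ≈⟨ R.*-congˡ u+d≈s ⟩
      (s + s) * s               ≈⟨ R.distribʳ s s s ⟩
      s * s + s * s             ≈⟨ R.+-congˡ s²≈x+e ⟩
      s * s + (x + e)           ≈⟨ R.sym (R.+-assoc (s * s) x e) ⟩
      s * s + x + e             ∎)

    u²≈x+d² : ∀ e d u → s * s ≈ x + e → (s + s) * d ≈ e → u + d ≈ s →
              u * u ≈ x + d * d
    u²≈x+d² e d u s²≈x+e 2sd≈e u+d≈s = +-cancelʳ e _ _ (begin
      u * u + e                             ≈⟨ R.+-congˡ (R.sym 2sd≈e) ⟩
      u * u + (s + s) * d
        ≈⟨ R.+-congˡ (R.*-congʳ (R.+-cong (R.sym u+d≈s) (R.sym u+d≈s))) ⟩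
      u * u + (u + d + (u + d)) * d
        ≈⟨ solve 2 (λ u d → u :* u :+ (u :+ d :+ (u :+ d)) :* d
                      := (u :+ d) :* (u :+ d) :+ d :* d) R.refl u d ⟩
      (u + d) * (u + d) + d * d             ≈⟨ R.+-congʳ (R.*-cong u+d≈s u+d≈s) ⟩
      s * s + d * d                         ≈⟨ R.+-congʳ s²≈x+e ⟩
      x + e + d * d
        ≈⟨ solve 3 (λ x e d → x :+ e :+ d :* d := x :+ d :* d :+ e) R.refl x e d ⟩
      x + d * d + e                         ∎)

  square-bound : ∀ {x y} → 0# ≤ x → y * y ≤ x → y ≤ 1# + x
  square-bound {x} 0≤x y²≤x = ≮⇒≤ λ 1+x<y →
    <⇒≱ (O.trans x<[1+x]² (square-< 0≤1+x 1+x<y)) y²≤x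
    where
    0≤1+x = +-nonneg (inj₁ 0<1) 0≤x
    x<[1+x]² : x < (1# + x) * (1# + x)
    x<[1+x]² = <-≤-trans (<-resp₂ R.refl (R.+-comm x 1#) (x<x+p x 0<1))
      (≤-resp₂ R.refl
        (R.trans (R.+-congʳ (R.sym (R.*-identityˡ _))) (R.sym (R.distribʳ (1# + x) 1# x)))
        (x≤x+p (1# + x) (*-nonneg 0≤x 0≤1+x)))

  sup-square : ∀ {x s} → 0# ≤ x → IsSupremum (λ y → y * y ≤ x) s → 0# ≤ s × s * s ≈ x
  sup-square {x} {s} 0≤x isSup with O.compare (s * s) x
  ... | tri≈ _ s²≈x _ = IsSupremum.upper isSup 0²≤x , s²≈x
    where 0²≤x = ≤-resp₂ (R.sym (R.zeroˡ 0#)) R.refl 0≤x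
  ... | tri< s²<x _ _ =
    let t , s<t , t²≤x = raise (upper (≤-resp₂ (R.sym (R.zeroˡ 0#)) R.refl 0≤x)) s²<x
    in ⊥-elim (<⇒≱ s<t (upper t²≤x))
    where open IsSupremum isSup
  ... | tri> _ _ x<s² =
    let t , 0<t , t<s , x≤t² = lower 0<s 0≤x x<s²
    in ⊥-elim (<⇒≱ t<s (least λ y²≤x → ≮⇒≤ λ t<y →
         <⇒≱ (≤-<-trans x≤t² (square-< (inj₁ 0<t) t<y)) y²≤x))
    where
    open IsSupremum isSup
    0<s : 0# < s
    0<s with upper (≤-resp₂ (R.sym (R.zeroˡ 0#)) R.refl 0≤x)
    ... | inj₁ p = p
    ... | inj₂ 0≈s = ⊥-elim (<⇒≱ x<s²
                       (≤-resp₂ (R.trans (R.sym (R.zeroˡ 0#)) (R.*-cong 0≈s 0≈s)) R.refl 0≤x))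

  sqrt : ∀ x → 0# ≤ x → ∃ λ y → 0# ≤ y × y * y ≈ x
  sqrt x 0≤x =
    let s , isSup = supremum (λ y → y * y ≤ x)
                      (0# , ≤-resp₂ (R.sym (R.zeroˡ 0#)) R.refl 0≤x)
                      (1# + x , square-bound 0≤x)
    in s , sup-square 0≤x isSup

  0≤x² : ∀ x → 0# ≤ x * x
  0≤x² x with O.compare 0# x
  ... | tri< 0<x _ _ = inj₁ (*-pos 0<x 0<x)
  ... | tri≈ _ 0≈x _ = inj₂ (R.trans (R.sym (R.zeroˡ 0#)) (R.*-cong 0≈x 0≈x))
  ... | tri> _ _ x<0 = ≤-resp₂ R.refl -x*-x≈x*x (*-nonneg 0≤-x 0≤-x)
    where
    0≤-x = inj₁ (<-resp₂ (R.-‿inverseˡ x) (R.+-identityʳ (- x)) (+-monoʳ-< (- x) x<0))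
    -x*-x≈x*x : (- x) * (- x) ≈ x * x
    -x*-x≈x*x = begin
      - x * - x     ≈⟨ R.sym (-‿distribˡ-* x (- x)) ⟩
      - (x * - x)   ≈⟨ R.-‿cong (R.sym (-‿distribʳ-* x x)) ⟩
      - (- (x * x)) ≈⟨ -‿involutive (x * x) ⟩
      x * x         ∎

  0≤x²+y² : ∀ x y → 0# ≤ x * x + y * y
  0≤x²+y² x y = +-nonneg (0≤x² x) (0≤x² y)

module Spectra (ℝ : CompleteOrderedField) where

  open CompleteOrderedField ℝ public using ()
    renaming (Carrier to Real; _≤_ to _≤ℝ_; _<_ to _<ℝ_; fromℕ to fromℕℝ)

  private module ℝ = CompleteOrderedField ℝ

  record ℂ : Set where
    constructor _+i_
    field
      re im : Real

  ℂ-rawRing : RawRing 0ℓ 0ℓ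
  ℂ-rawRing = record
    { Carrier = ℂ
    ; _≈_     = λ (a +i b) (c +i d) → a ℝ.≈ c × b ℝ.≈ d
    ; _+_     = λ (a +i b) (c +i d) → (a ℝ.+ c) +i (b ℝ.+ d)
    ; _*_     = λ (a +i b) (c +i d) →
                  (a ℝ.* c ℝ.+ ℝ.- (b ℝ.* d)) +i (a ℝ.* d ℝ.+ b ℝ.* c)
    ; -_      = λ (a +i b) → (ℝ.- a) +i (ℝ.- b)
    ; 0#      = ℝ.0# +i ℝ.0#
    ; 1#      = ℝ.1# +i ℝ.0#
    }

  open RawRing ℂ-rawRing public hiding (Carrier)
  open RawSemiringDefinitions rawSemiring public using (sum; _^_)

  fromℝ : Real → ℂ
  fromℝ x = x +i ℝ.0#

  -- The nonnegative square root of re² + im².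
  ∣_∣ : ℂ → Real
  ∣ a +i b ∣ = proj₁ (ℝ.sqrt (a ℝ.* a ℝ.+ b ℝ.* b) (ℝ.0≤x²+y² a b))

  Ball : Real → ℂ → Pred ℂ 0ℓ
  Ball r z w = ∣ z + - w ∣ <ℝ r

  𝒩 : Real → Pred ℂ 0ℓ → Pred ℂ 0ℓ
  𝒩 r S w = ∃ λ z → S z × Ball r z w

  -- A relation, since the infimum need not exist for arbitrary A and B.
  IsMinkowskiDistance : Pred ℂ 0ℓ → Pred ℂ 0ℓ → Real → Set
  IsMinkowskiDistance A B = ℝ.IsInfimum (λ r → A ⊆ 𝒩 r B × B ⊆ 𝒩 r A)

  infix 4 _=o_

  _=o_ : (ℕ → Real) → (ℕ → Real) → Set
  f =o g = ∀ ε → ℝ.0# <ℝ ε → ∃ λ N → ∀ n → N ℕ.≤ n →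
           ∣ fromℝ (f n) ∣ ≤ℝ ε ℝ.* ∣ fromℝ (g n) ∣

  Hypermatrix : ℕ → ℕ → Set
  Hypermatrix k n = Vec (Fin n) k → ℂ

  infixr 7 _·_

  _·_ : ∀ {k n} → ℂ → Hypermatrix k n → Hypermatrix k n
  (c · A) is = c * A is

  𝕁 : ∀ k n → Hypermatrix k n
  𝕁 k n is = 1#

  sumIndices : ∀ m {n} → (Vec (Fin n) m → ℂ) → ℂ
  sumIndices zero    f = f []
  sumIndices (suc m) f = sum λ i → sumIndices m λ is → f (i ∷ is)

  monomial : ∀ {m n} → Vector ℂ n → Vec (Fin n) m → ℂ
  monomial v is = Vec.foldr′ _*_ 1# (Vec.map v is)

  IsEigenpair : ∀ {m n} → Hypermatrix (suc m) n → ℂ → Vector ℂ n → Set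
  IsEigenpair {m} A z v =
    ∀ i → sumIndices m (λ is → A (i ∷ is) * monomial v is) ≈ z * v i ^ m

  IsEigenvalue : ∀ {m n} → Hypermatrix (suc m) n → Pred ℂ 0ℓ
  IsEigenvalue {n = n} A z =
    ∃ λ (v : Vector ℂ n) → ¬ (∀ i → v i ≈ 0#) × IsEigenpair A z v

  1/_! : ℕ → ℂ
  1/ m ! = fromℝ (fromℕℝ (m ℕ.!) ℝ.⁻¹)

  record UniformHypergraph (k n : ℕ) : Set₁ where
    field
      Edge    : Pred (Subset n) 0ℓ
      edge?   : Decidable Edge
      uniform : ∀ {e} → Edge e → card e ≡ k

  complete : ∀ k n → UniformHypergraph k n
  complete k n = record
    { Edge    = λ e → card e ≡ k
    ; edge?   = λ e → card e ℕₚ.≟ k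
    ; uniform = id
    }

  indexSet : ∀ {k n} → Vec (Fin n) k → Subset n
  indexSet is = ⋃ (List.map ⁅_⁆ (toList is))

  -- If an index repeats, card (indexSet is) < suc m, so by uniformity the
  -- entry is 0#.
  adjacency : ∀ {m n} → UniformHypergraph (suc m) n → Hypermatrix (suc m) n
  adjacency {m} H is = if does (edge? (indexSet is)) then 1/ m ! else 0#
    where open UniformHypergraph H

{-# OPTIONS --safe #-}
module Submission where

-- For k = 2 the adjacency matrix is J − I, so L and M differ by a unit shift.
--
-- For k = 3 write s = Σ vᵢ, Q = Σ vᵢ² and e = (s² − Q)/2. The eigenvalue
-- equations of ½𝕁 are s²/2 = λ vᵢ², so vᵢ = ±c and M consists of the numbers
-- D/2, D = (p − q)², p + q = n (and 0). Those of the complete hypergraph are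
-- μ vᵢ² − s vᵢ + e = 0 with μ = 1 − λ, so v takes at most two values a, b, say
-- p and q times; by Vieta μ(a + b) = s = pa + qb and μab = e, and eliminating
-- a and b gives the cubic 2μ³ + (D − 3n)μ² + 6pqμ − npq = 0. A root with
-- |μ| ≥ n lies within O(n) of −D/2; if |μ| < n, then λ is within O(n) of the
-- element D/2 of M with |p − q| ≤ 1. Conversely, if D > 8n, the cubic changes
-- sign between −D/2 and −D/2 + 3n, and if D ≤ 8n then D/2 is within O(n) of
-- 0 ∈ L, whose eigenvector is (1, 0, …, 0). So the distance is at most 8n.

open import Defs
open import Algebra.Bundles using (CommutativeRing)
import Algebra.Properties.Ring as RingProperties
import Algebra.Properties.Semiring.Mult as SemiringMult
import Algebra.Properties.Semiring.Sum as SemiringSum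
import Algebra.Solver.Ring as RingSolver
open import Algebra.Solver.Ring.AlmostCommutativeRing using (fromCommutativeRing; _-Raw-AlmostCommutative⟶_)
import Algebra.Solver.Ring.NaturalCoefficients.Default as NaturalSolver
open import Algebra.Structures using (IsCommutativeRing)
open import Data.Bool.Base using (Bool; if_then_else_; true; false)
open import Data.Fin.Base using (Fin; zero; suc)
import Data.Fin.Properties as Finₚ
open import Data.Fin.Subset using (Subset; ⁅_⁆; _∪_; _∈_; _∉_; inside; outside) renaming (∣_∣ to card; ⊥ to ∅)
import Data.Fin.Subset.Properties as Subsetₚ
open import Data.Integer.Base as ℤ using (ℤ; +_; -[1+_]; _⊖_; _◃_)
import Data.Integer.Properties as ℤₚ
open import Data.Maybe.Base using (Maybe; map)
open import Data.Nat.Base as ℕ using (ℕ; zero; suc)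
import Data.Nat.Properties as ℕₚ
open import Data.Product.Base using (∃; ∃₂; _×_; _,_; proj₁; proj₂)
import Data.Sign.Base as Sign
open import Data.Sum.Base as Sum using (_⊎_; inj₁; inj₂; [_,_]′)
open import Data.Vec.Base using (_∷_; here; there)
open import Data.Vec.Functional using (Vector)
open import Function.Base using (_∘_; id)
open import Level using (0ℓ)
open import Relation.Binary.Consequences using (dec⇒weaklyDec)
import Relation.Binary.Construct.StrictToNonStrict as StrictToNonStrict
open import Relation.Binary.Definitions using (Decidable; tri<; tri≈; tri>)
open import Relation.Binary.PropositionalEquality as ≡ using (_≡_)
import Relation.Binary.Reasoning.Setoid as ≈-Reasoning
open import Relation.Binary.Structures using (IsStrictTotalOrder)
open import Relation.Nullary using (¬_; does; yes; no; contradiction)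
open import Relation.Nullary.Decidable using (_×-dec_; dec-true; dec-false)
open import Relation.Unary using (Pred; _⊆_)

-- The distance is bounded by C n^(k-2), with C = 2 for k = 2 and C = 8 for k = 3, one power of n
-- below the claim. For k = 3 the two inclusions differ in nature. Locating a given eigenvalue of
-- the complete hypergraph takes only norm estimates: if |μ| ≥ n, then 4pq ≤ n² and division of the
-- cubic by μ² give |2μ + D - 3n| ≤ 7n/4. The converse has to produce an eigenvalue near D/2. It
-- comes from a real root of the cubic, found by the intermediate value theorem, together with the
-- explicit eigenvector whose two values are q - μ and μ - p. The threshold 8n keeps the whole
-- search interval for -μ, from D/2 - 3n to D/2, at or above n, where the term 3nμ² outweighs the
-- terms with pq. The elimination of a and b avoids division: the cubic is a quadratic form in (a,
-- b), expressing the second Vieta relation, evaluated at the direction that the first relation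
-- prescribes. Elimination presupposes μ ≠ 0 and two distinct values, so λ = 1 and constant
-- eigenvectors are separate cases.

-- Ring identities with integer coefficients.

module IntegerSolver (R : CommutativeRing 0ℓ 0ℓ) where
  open CommutativeRing R hiding (zero)
  open RingProperties ring
  open SemiringMult semiring renaming (_×_ to _×ᵣ_)
  open ≈-Reasoning setoid

  -- The canonical map from the integers. A constant `con (+ n)` of the solver thereby evaluates to
  -- `n ×ᵣ 1#`, the form in which numerals occur throughout.
  ⟦_⟧ᶻ : ℤ → Carrier
  ⟦ + n      ⟧ᶻ = n ×ᵣ 1#
  ⟦ -[1+ n ] ⟧ᶻ = - (suc n ×ᵣ 1#)

  ⊖-homo : ∀ m n → ⟦ m ⊖ n ⟧ᶻ ≈ m ×ᵣ 1# + - (n ×ᵣ 1#)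
  ⊖-homo m       zero    = sym (trans (+-congˡ -0#≈0#) (+-identityʳ _))
  ⊖-homo zero    (suc n) = sym (+-identityˡ _)
  ⊖-homo (suc m) (suc n) = begin
    ⟦ suc m ⊖ suc n ⟧ᶻ          ≡⟨ ≡.cong ⟦_⟧ᶻ (ℤₚ.[1+m]⊖[1+n]≡m⊖n m n) ⟩
    ⟦ m ⊖ n ⟧ᶻ                  ≈⟨ ⊖-homo m n ⟩
    x + - y                     ≈⟨ +-identityˡ _ ⟨
    0# + (x + - y)              ≈⟨ +-congʳ (-‿inverseʳ 1#) ⟨
    (1# + - 1#) + (x + - y)     ≈⟨ solve 4 (λ o o′ x y′ → (o :+ o′) :+ (x :+ y′) := (o :+ x) :+ (o′ :+ y′)) refl 1# (- 1#) x (- y) ⟩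
    (1# + x) + (- 1# + - y)     ≈⟨ +-congˡ (-‿+-comm 1# y) ⟩
    (1# + x) + - (1# + y)       ∎
    where
    x = m ×ᵣ 1#
    y = n ×ᵣ 1#
    open NaturalSolver commutativeSemiring using (solve; _:+_; _:=_)

  +-homo : ∀ i j → ⟦ i ℤ.+ j ⟧ᶻ ≈ ⟦ i ⟧ᶻ + ⟦ j ⟧ᶻ
  +-homo (+ m)    (+ n)    = ×-homo-+ 1# m n
  +-homo (+ m)    -[1+ n ] = ⊖-homo m (suc n)
  +-homo -[1+ m ] (+ n)    = trans (⊖-homo n (suc m)) (+-comm _ _)
  +-homo -[1+ m ] -[1+ n ] = begin
    - (suc (suc (m ℕ.+ n)) ×ᵣ 1#)          ≡⟨ ≡.cong (λ k → - (suc k ×ᵣ 1#)) (ℕₚ.+-suc m n) ⟨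
    - ((suc m ℕ.+ suc n) ×ᵣ 1#)            ≈⟨ -‿cong (×-homo-+ 1# (suc m) (suc n)) ⟩
    - (suc m ×ᵣ 1# + suc n ×ᵣ 1#)          ≈⟨ -‿+-comm _ _ ⟨
    - (suc m ×ᵣ 1#) + - (suc n ×ᵣ 1#)      ∎

  +◃-homo : ∀ n → ⟦ Sign.+ ◃ n ⟧ᶻ ≈ n ×ᵣ 1#
  +◃-homo zero    = refl
  +◃-homo (suc n) = refl

  -◃-homo : ∀ n → ⟦ Sign.- ◃ n ⟧ᶻ ≈ - (n ×ᵣ 1#)
  -◃-homo zero    = sym -0#≈0#
  -◃-homo (suc n) = refl

  *-homo : ∀ i j → ⟦ i ℤ.* j ⟧ᶻ ≈ ⟦ i ⟧ᶻ * ⟦ j ⟧ᶻ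
  *-homo (+ m)    (+ n)    = trans (+◃-homo (m ℕ.* n)) (×1-homo-* m n)
  *-homo (+ m)    -[1+ n ] = trans (-◃-homo (m ℕ.* suc n))
    (trans (-‿cong (×1-homo-* m (suc n))) (-‿distribʳ-* _ _))
  *-homo -[1+ m ] (+ n)    = trans (-◃-homo (suc m ℕ.* n))
    (trans (-‿cong (×1-homo-* (suc m) n)) (-‿distribˡ-* _ _))
  *-homo -[1+ m ] -[1+ n ] = begin
    (suc m ℕ.* suc n) ×ᵣ 1#                ≈⟨ ×1-homo-* (suc m) (suc n) ⟩
    x * y                                  ≈⟨ -‿involutive _ ⟨
    - (- (x * y))                          ≈⟨ -‿cong (-‿distribʳ-* x y) ⟩
    - (x * - y)                            ≈⟨ -‿distribˡ-* x (- y) ⟩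
    - x * - y                              ∎
    where
    x = suc m ×ᵣ 1#
    y = suc n ×ᵣ 1#

  -‿homo : ∀ i → ⟦ ℤ.- i ⟧ᶻ ≈ - ⟦ i ⟧ᶻ
  -‿homo (+ zero)  = sym -0#≈0#
  -‿homo (+ suc n) = refl
  -‿homo -[1+ n ]  = sym (-‿involutive _)

  homomorphism : ℤ.+-*-rawRing -Raw-AlmostCommutative⟶ fromCommutativeRing R
  homomorphism = record
    { ⟦_⟧    = ⟦_⟧ᶻ
    ; +-homo = +-homo
    ; *-homo = *-homo
    ; -‿homo = -‿homo
    ; 0-homo = refl
    ; 1-homo = +-identityʳ 1#
    }

  weaklyDec : ∀ i j → Maybe (⟦ i ⟧ᶻ ≈ ⟦ j ⟧ᶻ)
  weaklyDec i j = map (λ { ≡.refl → refl }) (dec⇒weaklyDec ℤₚ._≟_ i j)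

  open RingSolver _ _ homomorphism weaklyDec public
    using (solve; con; _:+_; _:*_; :-_; _:=_)

-- Algebra of vectors with two values over a commutative ring.

module TwoValues (R : CommutativeRing 0ℓ 0ℓ) where
  open CommutativeRing R hiding (zero)
  open SemiringMult semiring using () renaming (_×_ to _×ᵣ_)
  open IntegerSolver R
  open ≈-Reasoning setoid

  ι : ℕ → Carrier
  ι n = n ×ᵣ 1#

  -- Vanishes iff μab is the second elementary symmetric polynomial of the
  -- vector with p entries a and q entries b.
  form : (p q μ a b : Carrier) → Carrier
  form p q μ a b =
    (p * a + q * b) * (p * a + q * b) + - (p * (a * a)) + - (q * (b * b)) + - (ι 2 * μ * (a * b))

  -- When μ(a + b) = pa + qb, the pair (a , b) is proportional to (q - μ , μ - p).
  charPoly : (p q μ : Carrier) → Carrier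
  charPoly p q μ = form p q μ (q + - μ) (μ + - p)

  quadratic : (μ s e x : Carrier) → Carrier
  quadratic μ s e x = μ * (x * x) + - (s * x) + e

  form-cong : ∀ {p q μ a a′ b b′} → a ≈ a′ → b ≈ b′ → form p q μ a b ≈ form p q μ a′ b′
  form-cong a≈ b≈ = +-cong (+-cong (+-cong
    (*-cong pa+qb≈ pa+qb≈) (-‿cong (*-congˡ (*-cong a≈ a≈)))) (-‿cong (*-congˡ (*-cong b≈ b≈))))
    (-‿cong (*-congˡ (*-cong a≈ b≈)))
    where pa+qb≈ = +-cong (*-congˡ a≈) (*-congˡ b≈)

  form-homogeneous : ∀ p q μ c a b → form p q μ (c * a) (c * b) ≈ c * c * form p q μ a b
  form-homogeneous = solve 6 (λ p q μ c a b →
    let f = λ a b → (p :* a :+ q :* b) :* (p :* a :+ q :* b) :+ :- (p :* (a :* a))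
                    :+ :- (q :* (b :* b)) :+ :- (con (+ 2) :* μ :* (a :* b))
    in f (c :* a) (c :* b) := c :* c :* f a b) refl

  charPoly-expand : ∀ p q μ → charPoly p q μ ≈
    μ * μ * (ι 2 * μ + (p + - q) * (p + - q) + - (ι 3 * (p + q)))
      + - (p * q * ((p + q) + - (ι 6 * μ)))
  charPoly-expand = solve 3 (λ p q μ →
    let f = λ a b → (p :* a :+ q :* b) :* (p :* a :+ q :* b) :+ :- (p :* (a :* a))
                    :+ :- (q :* (b :* b)) :+ :- (con (+ 2) :* μ :* (a :* b))
    in f (q :+ :- μ) (μ :+ :- p) :=
       μ :* μ :* (con (+ 2) :* μ :+ (p :+ :- q) :* (p :+ :- q) :+ :- (con (+ 3) :* (p :+ q)))
         :+ :- (p :* q :* ((p :+ q) :+ :- (con (+ 6) :* μ)))) refl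

  open RingProperties ring using () renaming (x≈y⇒x∙y⁻¹≈ε to x≈y⇒x-y≈0; x∙y⁻¹≈ε⇒x≈y to x-y≈0⇒x≈y)

  -- The first Vieta relation says (μ - p)a = (q - μ)b, so a times (q - μ, μ - p) equals (q - μ)
  -- times (a, b), and similarly for b. Homogeneity of degree two moves the vanishing of `form` from
  -- one pair to the other; the squares remain because nothing is divided.
  charPoly-root : ∀ {p q μ a b} → μ * (a + b) ≈ p * a + q * b → form p q μ a b ≈ 0# →
                  a * a * charPoly p q μ ≈ 0# × b * b * charPoly p q μ ≈ 0#
  charPoly-root {p} {q} {μ} {a} {b} vieta form≈0 =
    (begin
      a * a * charPoly p q μ                         ≈⟨ form-homogeneous p q μ a _ _ ⟨
      form p q μ (a * (q + - μ)) (a * (μ + - p))     ≈⟨ form-cong (*-comm a _) (trans (*-comm a _) cross) ⟩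
      form p q μ ((q + - μ) * a) ((q + - μ) * b)     ≈⟨ form-homogeneous p q μ _ a b ⟩
      (q + - μ) * (q + - μ) * form p q μ a b         ≈⟨ *-congˡ form≈0 ⟩
      (q + - μ) * (q + - μ) * 0#                     ≈⟨ zeroʳ _ ⟩
      0#                                             ∎) ,
    (begin
      b * b * charPoly p q μ                         ≈⟨ form-homogeneous p q μ b _ _ ⟨
      form p q μ (b * (q + - μ)) (b * (μ + - p))     ≈⟨ form-cong (trans (*-comm b _) (sym cross)) (*-comm b _) ⟩
      form p q μ ((μ + - p) * a) ((μ + - p) * b)     ≈⟨ form-homogeneous p q μ _ a b ⟩
      (μ + - p) * (μ + - p) * form p q μ a b         ≈⟨ *-congˡ form≈0 ⟩
      (μ + - p) * (μ + - p) * 0#                     ≈⟨ zeroʳ _ ⟩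
      0#                                             ∎)
    where
    cross : (μ + - p) * a ≈ (q + - μ) * b
    cross = x-y≈0⇒x≈y _ _ (trans
      (solve 5 (λ p q μ a b → (μ :+ :- p) :* a :+ :- ((q :+ :- μ) :* b)
                 := μ :* (a :+ b) :+ :- (p :* a :+ q :* b)) refl p q μ a b)
      (x≈y⇒x-y≈0 vieta))

  -- Subtracting the two root equations cancels e and leaves the factor a - b, to be removed where a
  -- and b are known to differ.
  vieta-sum : ∀ {μ s e a b} → quadratic μ s e a ≈ 0# → quadratic μ s e b ≈ 0# →
              (a + - b) * (μ * (a + b) + - s) ≈ 0#
  vieta-sum {μ} {s} {e} {a} {b} ra rb = trans
    (solve 5 (λ μ s e a b → (a :+ :- b) :* (μ :* (a :+ b) :+ :- s) :=
        (μ :* (a :* a) :+ :- (s :* a) :+ e) :+ :- (μ :* (b :* b) :+ :- (s :* b) :+ e)) refl μ s e a b)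
    (x≈y⇒x-y≈0 (trans ra (sym rb)))

  quadratic-factors : ∀ {μ s e a b} → μ * (a + b) ≈ s → μ * (a * b) ≈ e →
                      ∀ x → quadratic μ s e x ≈ μ * ((x + - a) * (x + - b))
  quadratic-factors {μ} {s} {e} {a} {b} s≈ e≈ x = begin
    μ * (x * x) + - (s * x) + e
      ≈⟨ +-cong (+-congˡ (-‿cong (*-congʳ s≈))) e≈ ⟨
    μ * (x * x) + - (μ * (a + b) * x) + μ * (a * b)
      ≈⟨ solve 4 (λ μ a b x → μ :* (x :* x) :+ :- (μ :* (a :+ b) :* x) :+ μ :* (a :* b)
                   := μ :* ((x :+ :- a) :* (x :+ :- b))) refl μ a b x ⟩
    μ * ((x + - a) * (x + - b)) ∎

  -- Once the sum relation is known, a single root determines e = sa - μa² = μab.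
  quadratic-root⇒vieta-product : ∀ {μ s e a b} → μ * (a + b) ≈ s → quadratic μ s e a ≈ 0# → μ * (a * b) ≈ e
  quadratic-root⇒vieta-product {μ} {s} {e} {a} {b} s≈ ra = sym (x-y≈0⇒x≈y _ _ (begin
    e + - (μ * (a * b))
      ≈⟨ solve 4 (λ μ e a b → e :+ :- (μ :* (a :* b)) := μ :* (a :* a) :+ :- (μ :* (a :+ b) :* a) :+ e) refl μ e a b ⟩
    μ * (a * a) + - (μ * (a + b) * a) + e
      ≈⟨ +-congʳ (+-congˡ (-‿cong (*-congʳ s≈))) ⟩
    quadratic μ s e a ≈⟨ ra ⟩
    0# ∎))

  open SemiringSum semiring using (sum; sum-cong-≋; ∑-distrib-+; *-distribˡ-sum)

  private variable n : ℕ

  -- The counts are chosen before `g`, so that the same p and q serve both Σ vᵢ and Σ vᵢ².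
  sum-twoValued : ∀ {a b} (v : Vector Carrier n) → (∀ i → v i ≈ a ⊎ v i ≈ b) →
    ∃₂ λ p q → p ℕ.+ q ≡ n × ∀ (g : Carrier → Carrier) → (∀ {x y} → x ≈ y → g x ≈ g y) →
      sum (g ∘ v) ≈ ι p * g a + ι q * g b
  sum-twoValued {n = zero} v _ = 0 , 0 , ≡.refl , λ g _ →
    sym (trans (+-cong (zeroˡ _) (zeroˡ _)) (+-identityˡ 0#))
  sum-twoValued {n = suc n} {a} {b} v two with v zero | two zero | sum-twoValued (v ∘ suc) (two ∘ suc)
  ... | x | inj₁ x≈a | p , q , p+q≡n , eq = suc p , q , ≡.cong suc p+q≡n , λ g g-cong →
    trans (+-cong (g-cong x≈a) (eq g g-cong))
      (trans (sym (+-assoc _ _ _)) (+-congʳ (sym (trans (distribʳ _ _ _) (+-congʳ (*-identityˡ _))))))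
  ... | x | inj₂ x≈b | p , q , p+q≡n , eq = p , suc q , ≡.trans (ℕₚ.+-suc p q) (≡.cong suc p+q≡n) , λ g g-cong →
    trans (+-cong (g-cong x≈b) (eq g g-cong))
      (trans (sym (+-assoc _ _ _)) (trans (+-congʳ (+-comm _ _)) (trans (+-assoc _ _ _)
        (+-congˡ (sym (trans (distribʳ _ _ _) (+-congʳ (*-identityˡ _))))))))

  twoValued : ∀ p q → Carrier → Carrier → Vector Carrier (p ℕ.+ q)
  twoValued zero    q a b _       = b
  twoValued (suc p) q a b zero    = a
  twoValued (suc p) q a b (suc i) = twoValued p q a b i

  twoValued-values : ∀ p q a b i → twoValued p q a b i ≡ a ⊎ twoValued p q a b i ≡ b
  twoValued-values zero    q a b _       = inj₂ ≡.refl
  twoValued-values (suc p) q a b zero    = inj₁ ≡.refl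
  twoValued-values (suc p) q a b (suc i) = twoValued-values p q a b i

  sum-const : ∀ n x → sum {n} (λ _ → x) ≈ ι n * x
  sum-const zero    x = sym (zeroˡ x)
  sum-const (suc n) x = sym (trans (distribʳ _ _ _) (+-cong (*-identityˡ x) (sym (sum-const n x))))

  twoValued-sum : ∀ p q a b (g : Carrier → Carrier) →
                  sum (g ∘ twoValued p q a b) ≈ ι p * g a + ι q * g b
  twoValued-sum zero q a b g = trans (sum-const q (g b)) (sym (trans (+-congʳ (zeroˡ _)) (+-identityˡ _)))
  twoValued-sum (suc p) q a b g = trans (+-congˡ (twoValued-sum p q a b g))
    (trans (sym (+-assoc _ _ _)) (+-congʳ (sym (trans (distribʳ _ _ _) (+-congʳ (*-identityˡ _))))))

  -- Sums over distinct indices.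

  except : Fin n → Vector Carrier n → Vector Carrier n
  except i f j = if does (j Finₚ.≟ i) then 0# else f j

  except-≢ : ∀ {i j : Fin n} f → ¬ j ≡ i → except i f j ≈ f j
  except-≢ {i = i} {j} f j≢i with j Finₚ.≟ i
  ... | yes j≡i = contradiction j≡i j≢i
  ... | no _    = refl

  sum-except : ∀ (i : Fin n) f → sum (except i f) + f i ≈ sum f
  sum-except zero    f = trans (+-comm _ _) (+-congˡ (+-identityˡ _))
  sum-except (suc i) f = trans (+-assoc _ _ _) (+-congˡ (sum-except i (f ∘ suc)))

  -- For h = 1/2 this is the second elementary symmetric polynomial, written through power sums by
  -- Newton's identity.
  e₂ : Carrier → Vector Carrier n → Carrier
  e₂ h v = h * (sum v * sum v + - sum (λ i → v i * v i))

  module _ {h : Carrier} (h*2≈1 : h * ι 2 ≈ 1#) (v : Vector Carrier n) where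
    private
      s = sum v

    -- Meant for t = s - vᵢ: when j differs from i, the summand is then h vⱼ times the sum of the
    -- entries other than i and j.
    sum-pairs-except : ∀ (t : Carrier) → sum (λ j → h * (v j * (t + - v j))) ≈ h * (t * s + - sum (λ j → v j * v j))
    sum-pairs-except t = begin
      sum (λ j → h * (v j * (t + - v j)))
        ≈⟨ sum-cong-≋ {n} (λ j → solve 3 (λ h t x → h :* (x :* (t :+ :- x)) := h :* t :* x :+ (:- h) :* (x :* x)) refl h t (v j)) ⟩
      sum (λ j → h * t * v j + - h * (v j * v j))
        ≈⟨ ∑-distrib-+ {n} (λ j → h * t * v j) (λ j → - h * (v j * v j)) ⟩
      sum (λ j → h * t * v j) + sum (λ j → - h * (v j * v j))
        ≈⟨ +-cong (*-distribˡ-sum {n} _ _) (*-distribˡ-sum {n} _ _) ⟨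
      h * t * s + - h * sum (λ j → v j * v j)
        ≈⟨ solve 4 (λ h t s Q → h :* t :* s :+ (:- h) :* Q := h :* (t :* s :+ :- Q)) refl h t s _ ⟩
      h * (t * s + - sum (λ j → v j * v j)) ∎

    -- Ordered pairs weighted by 1/2 count each unordered pair once, so the left side is the second
    -- elementary symmetric polynomial of v without its entry i. Removing that entry takes vᵢ(s -
    -- vᵢ) away from `e₂`.
    sum-distinct-pairs : ∀ (i : Fin n) (f : Fin n → Carrier) →
      (∀ {j} → ¬ j ≡ i → f j ≈ sum (except j (except i (λ l → h * (v j * v l))))) → f i ≈ 0# →
      sum f ≈ e₂ h v + - (s * v i) + v i * v i
    sum-distinct-pairs i f f≈ fi≈0 = begin
      sum f                            ≈⟨ sum-cong-≋ {n} f≈except ⟩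
      -- The value `g i` = h x (s - 2x) need not vanish, so it is added to complete the sum over all
      -- j and subtracted again.
      sum (except i g)                 ≈⟨ trans (sym (+-identityʳ _)) (trans (+-congˡ (sym (-‿inverseʳ (g i)))) (sym (+-assoc _ _ _))) ⟩
      sum (except i g) + g i + - g i   ≈⟨ +-congʳ (trans (sum-except i g) (sum-pairs-except _)) ⟩
      h * ((s + - x) * s + - Q) + - (h * (x * ((s + - x) + - x)))
        ≈⟨ solve 4 (λ h s x Q → h :* ((s :+ :- x) :* s :+ :- Q) :+ :- (h :* (x :* ((s :+ :- x) :+ :- x)))
              := h :* (s :* s :+ :- Q) :+ (h :* con (+ 2)) :* (x :* x :+ :- (s :* x))) refl h s x Q ⟩
      h * (s * s + - Q) + h * ι 2 * (x * x + - (s * x))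
        ≈⟨ +-congˡ (trans (*-congʳ h*2≈1) (trans (*-identityˡ _) (+-comm _ _))) ⟩
      e₂ h v + (- (s * x) + x * x)          ≈⟨ +-assoc _ _ _ ⟨
      e₂ h v + - (s * x) + x * x            ∎
      where
      x = v i
      Q = sum (λ j → v j * v j)
      g : Vector Carrier n
      g j = h * (v j * ((s + - x) + - v j))
      inner : ∀ {j} → ¬ j ≡ i → f j ≈ g j
      inner {j} j≢i = trans (f≈ j≢i) (begin
        sum (except j w′)                     ≈⟨ trans (+-cong (+-identityʳ _) refl) (+-identityʳ _) ⟨
        sum (except j w′) + 0# + 0#           ≈⟨ +-cong (+-congˡ (-‿inverseʳ (w j))) (-‿inverseʳ (w i)) ⟨
        sum (except j w′) + (w j + - w j) + (w i + - w i)
          ≈⟨ solve 3 (λ A B C → A :+ (B :+ :- B) :+ (C :+ :- C) := A :+ B :+ C :+ (:- B :+ :- C)) refl _ (w j) (w i) ⟩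
        sum (except j w′) + w j + w i + (- w j + - w i)
          ≈⟨ +-congʳ (+-congʳ (trans (+-congˡ (sym (except-≢ w j≢i))) (sum-except j w′))) ⟩
        sum w′ + w i + (- w j + - w i)        ≈⟨ +-congʳ (sum-except i w) ⟩
        sum w + (- w j + - w i)
          ≈⟨ +-congʳ (trans (sum-cong-≋ {n} (λ l → sym (*-assoc _ _ _))) (sym (*-distribˡ-sum {n} (h * v j) v))) ⟩
        h * v j * s + (- w j + - w i)
          ≈⟨ solve 4 (λ h s x y → h :* y :* s :+ (:- (h :* (y :* y)) :+ :- (h :* (y :* x)))
               := h :* (y :* ((s :+ :- x) :+ :- y))) refl h s x (v j) ⟩
        g j ∎)
        where
        w w′ : Vector Carrier n
        w l = h * (v j * v l)
        w′ = except i w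
      f≈except : ∀ j → f j ≈ except i g j
      f≈except j with j Finₚ.≟ i
      ... | yes ≡.refl = fi≈0
      ... | no j≢i     = inner j≢i

  -- The factors `1#` are those left by unfolding: `c * 1#` is an entry of the scaled all-ones
  -- hypermatrix, and `v j * 1#` ends the fold that defines a monomial.
  sum-constantEntries : ∀ (c : Carrier) (v : Vector Carrier n) →
    sum {n} (λ j → c * 1# * (v j * 1#)) ≈ c * sum v
  sum-constantEntries {n} c v = trans (sum-cong-≋ {n} (λ j → *-cong (*-identityʳ c) (*-identityʳ (v j))))
    (sym (*-distribˡ-sum {n} c v))

  sum-constantEntries₂ : ∀ (c : Carrier) (v : Vector Carrier n) →
    sum {n} (λ j → sum {n} (λ l → c * 1# * (v j * (v l * 1#)))) ≈ c * (sum v * sum v)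
  sum-constantEntries₂ {n} c v = trans
    (sum-cong-≋ {n} (λ j → trans (sum-cong-≋ {n} (λ l →
        trans (*-cong (*-identityʳ c) (*-congˡ (*-identityʳ (v l)))) (sym (*-assoc c (v j) (v l)))))
      (trans (sym (*-distribˡ-sum {n} (c * v j) v))
        (solve 3 (λ c x s → c :* x :* s := c :* s :* x) refl c (v j) (sum v)))))
    (trans (sym (*-distribˡ-sum {n} (c * sum v) v)) (*-assoc c (sum v) (sum v)))

  if-true : ∀ {b} {x y : Carrier} → b ≡ true → (if b then x else 0#) * y ≈ x * y
  if-true ≡.refl = refl

  if-false : ∀ {b} {x y : Carrier} → b ≡ false → (if b then x else 0#) * y ≈ 0#
  if-false ≡.refl = zeroˡ _

  sum-distinctEntries : ∀ {c : Fin n → Bool} (h : Carrier) (v : Vector Carrier n) (i : Fin n) →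
    (∀ {j} → ¬ j ≡ i → c j ≡ true) → c i ≡ false →
    sum {n} (λ j → (if c j then h else 0#) * (v j * 1#)) + h * v i ≈ h * sum v
  sum-distinctEntries {n} {c} h v i on off = begin
    sum (λ j → (if c j then h else 0#) * (v j * 1#)) + h * v i   ≈⟨ +-congʳ (sum-cong-≋ {n} entries) ⟩
    sum (except i (λ j → h * v j)) + h * v i                     ≈⟨ sum-except i (λ j → h * v j) ⟩
    sum (λ j → h * v j)                                          ≈⟨ *-distribˡ-sum {n} h v ⟨
    h * sum v                                                    ∎
    where
    entries : ∀ j → (if c j then h else 0#) * (v j * 1#) ≈ except i (λ j → h * v j) j
    entries j with j Finₚ.≟ i
    ... | yes ≡.refl = if-false off
    ... | no j≢i     = trans (if-true (on j≢i)) (*-congˡ (*-identityʳ (v j)))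

  sum-distinctEntries₂ : ∀ {c : Fin n → Fin n → Bool} {h : Carrier} → h * ι 2 ≈ 1# → ∀ (v : Vector Carrier n) (i : Fin n) →
    (∀ {j l} → ¬ j ≡ i → ¬ l ≡ i → ¬ l ≡ j → c j l ≡ true) →
    (∀ l → c i l ≡ false) → (∀ j → c j i ≡ false) → (∀ j → c j j ≡ false) →
    sum {n} (λ j → sum {n} (λ l → (if c j l then h else 0#) * (v j * (v l * 1#)))) ≈ e₂ h v + - (sum v * v i) + v i * v i
  sum-distinctEntries₂ {n} {c} {h} h*2≈1 v i on off₁ off₂ off₃ = sum-distinct-pairs h*2≈1 v i _
    (λ {j} j≢i → sum-cong-≋ {n} (entries j≢i))
    (trans (sum-cong-≋ {n} (λ l → if-false (off₁ l))) (trans (sum-const n 0#) (zeroʳ _)))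
    where
    entries : ∀ {j} → ¬ j ≡ i → ∀ l → (if c j l then h else 0#) * (v j * (v l * 1#)) ≈
              except j (except i (λ l → h * (v j * v l))) l
    entries {j} j≢i l with l Finₚ.≟ j | l Finₚ.≟ i
    ... | yes ≡.refl | _          = if-false (off₃ l)
    ... | no _       | yes ≡.refl = if-false (off₂ j)
    ... | no l≢j     | no l≢i     = trans (if-true (on j≢i l≢i l≢j)) (*-congˡ (*-congˡ (*-identityʳ (v l))))

-- Order and intermediate values in the reals.

module RealOrder (ℝ : CompleteOrderedField) where
  open CompleteOrderedField ℝ
  open CommutativeRing commutativeRing using
    ( ring; setoid; refl; sym; trans; isEquivalence; +-cong; +-congˡ; +-congʳ; *-cong; *-congˡ; *-congʳ; -‿cong
    ; -‿inverseˡ; +-identityˡ; +-identityʳ; +-assoc; +-comm; *-identityˡ; zeroʳ; distribˡ )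
  open RingProperties ring using () renaming (x∙y⁻¹≈ε⇒x≈y to x-y≈0⇒x≈y)
  open IntegerSolver commutativeRing
  open TwoValues commutativeRing using (ι; charPoly; charPoly-expand)
  private
    module O = IsStrictTotalOrder isStrictTotalOrder
    module N = StrictToNonStrict _≈_ _<_
  open O using (compare; irrefl) renaming (_≟_ to _≈?_) public
  open ≈-Reasoning setoid

  ≤-trans : ∀ {a b c} → a ≤ b → b ≤ c → a ≤ c
  ≤-trans = N.trans isEquivalence O.<-resp-≈ O.trans

  -- Inequalities are proved by writing b - a as a visibly nonnegative
  -- polynomial in slack variables.
  ≤-slack : ∀ {a b} c → 0# ≤ c → b ≈ a + c → a ≤ b
  ≤-slack c 0≤c b≈ = ≤-resp₂ refl (sym b≈) (x≤x+p _ 0≤c)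

  ≤-gap : ∀ {a b} → a ≤ b → ∃ λ c → 0# ≤ c × b ≈ a + c
  ≤-gap (inj₁ a<b) = let c , 0<c , b≈ = gap a<b in c , inj₁ 0<c , b≈
  ≤-gap (inj₂ a≈b) = 0# , inj₂ refl , trans (sym a≈b) (sym (+-identityʳ _))

  0≤ι : ∀ n → 0# ≤ ι n
  0≤ι zero    = inj₂ refl
  0≤ι (suc n) = +-nonneg (inj₁ 0<1) (0≤ι n)

  0<ι : ∀ n → 0# < ι (suc n)
  0<ι n = <-≤-trans 0<1 (x≤x+p 1# (0≤ι n))

  +-mono-≤ : ∀ {a b c d} → a ≤ b → c ≤ d → a + c ≤ b + d
  +-mono-≤ {a} {b} {c} {d} a≤b c≤d =
    let x , 0≤x , b≈ = ≤-gap a≤b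
        y , 0≤y , d≈ = ≤-gap c≤d
    in ≤-slack (x + y) (+-nonneg 0≤x 0≤y) (trans (+-cong b≈ d≈)
         (solve 4 (λ a c x y → (a :+ x) :+ (c :+ y) := (a :+ c) :+ (x :+ y)) refl a c x y))

  *-monoʳ-≤ : ∀ {c a b} → 0# ≤ c → a ≤ b → c * a ≤ c * b
  *-monoʳ-≤ {c} {a} 0≤c a≤b =
    let x , 0≤x , b≈ = ≤-gap a≤b
    in ≤-slack (c * x) (*-nonneg 0≤c 0≤x) (trans (*-congˡ b≈) (distribˡ c a x))

  *-monoʳ-< : ∀ {c a b} → 0# < c → a < b → c * a < c * b
  *-monoʳ-< {c} {a} 0<c a<b =
    let x , 0<x , b≈ = gap a<b
    in <-resp₂ refl (sym (trans (*-congˡ b≈) (distribˡ c a x))) (x<x+p _ (*-pos 0<c 0<x))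

  *-cancelˡ-≤ : ∀ {c a b} → 0# < c → c * a ≤ c * b → a ≤ b
  *-cancelˡ-≤ 0<c ca≤cb = ≮⇒≤ λ b<a → <⇒≱ (*-monoʳ-< 0<c b<a) ca≤cb

  square-cancel-≤ : ∀ {a b} → 0# ≤ b → a * a ≤ b * b → a ≤ b
  square-cancel-≤ 0≤b a²≤b² = ≮⇒≤ λ b<a → <⇒≱ (square-< 0≤b b<a) a²≤b²

  ≤-antisym : ∀ {a b} → a ≤ b → b ≤ a → a ≈ b
  ≤-antisym (inj₂ a≈b) _   = a≈b
  ≤-antisym (inj₁ a<b) b≤a = contradiction b≤a (<⇒≱ a<b)

  *-zero-divisor-free : ∀ {a b} → a * b ≈ 0# → a ≈ 0# ⊎ b ≈ 0#
  *-zero-divisor-free {a} {b} ab≈0 with a ≈? 0#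
  ... | yes a≈0 = inj₁ a≈0
  ... | no a≉0  = inj₂ (begin
    b                ≈⟨ *-identityˡ b ⟨
    1# * b           ≈⟨ *-congʳ (*-inverseʳ a a≉0) ⟨
    a * a ⁻¹ * b     ≈⟨ solve 3 (λ a i b → a :* i :* b := i :* (a :* b)) refl a (a ⁻¹) b ⟩
    a ⁻¹ * (a * b)   ≈⟨ *-congˡ ab≈0 ⟩
    a ⁻¹ * 0#        ≈⟨ zeroʳ _ ⟩
    0#               ∎)

  infimum : (P : Pred Carrier 0ℓ) → ∃ P → ∃ (LowerBound P) → ∃ (IsInfimum P)
  infimum P (x , Px) lb =
    let s , isSup = supremum (LowerBound P) lb (x , λ l≤ → l≤ Px)
    in s , record
      { lower    = λ Py → IsSupremum.least isSup λ l≤ → l≤ Py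
      ; greatest = λ l≤ → IsSupremum.upper isSup l≤
      }

  -- A one-sided Lipschitz bound suffices: it keeps f positive to the left of
  -- a point where it is positive, and negative to the right of a point where
  -- it is negative.
  intermediate-value : ∀ (f : Carrier → Carrier) {lo hi K} → (∀ {x y} → x ≈ y → f x ≈ f y) →
    lo ≤ hi → 0# < K → (∀ {x t} → lo ≤ x → 0# ≤ t → x + t ≤ hi → f (x + t) ≤ f x + K * t) →
    f lo ≤ 0# → 0# ≤ f hi → ∃ λ x → lo ≤ x × x ≤ hi × f x ≈ 0#
  intermediate-value f {lo} {hi} {K} f-cong lo≤hi 0<K lipschitz flo≤0 0≤fhi
    with supremum (λ x → lo ≤ x × x ≤ hi × f x ≤ 0#) (lo , inj₂ refl , lo≤hi , flo≤0) (hi , proj₁ ∘ proj₂)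
  ... | s , isSup = s , lo≤s , s≤hi , fs≈0
    where
    open IsSupremum isSup
    lo≤s = upper (inj₂ refl , lo≤hi , flo≤0)
    s≤hi = least (proj₁ ∘ proj₂)

    fs≮0 : ¬ f s < 0#
    fs≮0 fs<0 with s≤hi
    ... | inj₂ s≈hi = <⇒≱ fs<0 (≤-resp₂ refl (sym (f-cong s≈hi)) 0≤fhi)
    ... | inj₁ s<hi =
      -- With d = -f(s)/K and e = hi - s, a step t ≤ d keeps f(s + t) ≤ 0 and t ≤ e keeps s + t in
      -- the interval, against s being an upper bound.
      let c , 0<c , 0≈fs+c = gap fs<0
          d , 0<d , Kd≈c   = divide c 0<K 0<c
          e , 0<e , hi≈s+e = gap s<hi
          t , 0<t , t≤d , t≤e = min 0<d 0<e
          f[s+t]≤0 = ≤-trans (lipschitz lo≤s (inj₁ 0<t) (≤-resp₂ refl (sym hi≈s+e) (+-mono-≤ (inj₂ refl) t≤e)))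
                       (≤-resp₂ refl (trans (+-congˡ Kd≈c) (sym 0≈fs+c)) (+-mono-≤ (inj₂ refl) (*-monoʳ-≤ (inj₁ 0<K) t≤d)))
      in <⇒≱ (x<x+p s 0<t) (upper (≤-trans lo≤s (x≤x+p s (inj₁ 0<t)) ,
           ≤-resp₂ refl (sym hi≈s+e) (+-mono-≤ (inj₂ refl) t≤e) , f[s+t]≤0))
      where
      min : ∀ {d e} → 0# < d → 0# < e → ∃ λ t → 0# < t × t ≤ d × t ≤ e
      min {d} {e} 0<d 0<e with compare d e
      ... | tri< d<e _ _ = d , 0<d , inj₂ refl , inj₁ d<e
      ... | tri≈ _ d≈e _ = d , 0<d , inj₂ refl , inj₂ d≈e
      ... | tri> _ _ e<d = e , 0<e , inj₁ e<d , inj₂ refl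

    0≮fs : ¬ 0# < f s
    0≮fs 0<fs =
      let d , 0<d , Kd≈fs = divide (f s) 0<K 0<fs
          s-d+d≈s = trans (+-assoc s (- d) d) (trans (+-congˡ (-‿inverseˡ d)) (+-identityʳ s))
          -- If x > s - d and f x ≤ 0, then s = x + t with t < d, whence f s ≤ K t < K d = f s. So s
          -- - d would already be an upper bound.
          bound : UpperBound _ (s + - d)
          bound {x} (lo≤x , x≤hi , fx≤0) = ≮⇒≤ λ s-d<x →
            let t , 0≤t , s≈x+t = ≤-gap (upper (lo≤x , x≤hi , fx≤0))
                x+t<x+d = <-resp₂ (trans (+-comm d _) (trans s-d+d≈s s≈x+t)) (+-comm d x) (+-monoʳ-< d s-d<x)
                t<d     = <-resp₂ (cancel x t) (cancel x d) (+-monoʳ-< (- x) x+t<x+d)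
            in <⇒≱ (*-monoʳ-< 0<K t<d) (≤-trans (inj₂ Kd≈fs)
                 (≤-trans (≤-resp₂ (f-cong (sym s≈x+t)) refl (lipschitz lo≤x 0≤t (≤-resp₂ s≈x+t refl s≤hi)))
                   (≤-resp₂ refl (+-identityˡ _) (+-mono-≤ fx≤0 (inj₂ refl)))))
      in <⇒≱ (<-resp₂ refl s-d+d≈s (x<x+p (s + - d) 0<d)) (least bound)
      where
      cancel : ∀ x y → - x + (x + y) ≈ y
      cancel = solve 2 (λ x y → :- x :+ (x :+ y) := y) refl

    fs≈0 : f s ≈ 0#
    fs≈0 with compare (f s) 0#
    ... | tri< fs<0 _ _ = contradiction fs<0 fs≮0
    ... | tri≈ _ fs≈0 _ = fs≈0
    ... | tri> _ _ 0<fs = contradiction 0<fs 0≮fs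

  -- The cubic at real arguments.

  charPoly-cong : ∀ p q {μ μ′} → μ ≈ μ′ → charPoly p q μ ≈ charPoly p q μ′
  charPoly-cong p q {μ} {μ′} μ≈ = trans (charPoly-expand p q μ) (trans
    (+-cong (*-cong (*-cong μ≈ μ≈) (+-congʳ (+-congʳ (*-congˡ μ≈))))
            (-‿cong (*-congˡ (+-congˡ (-‿cong (*-congˡ μ≈))))))
    (sym (charPoly-expand p q μ′)))

  -- The roots sought lie near -D/2. Working with x = -μ keeps the variable nonnegative, as the
  -- slack polynomials require.
  charPoly-at : ∀ p q x → charPoly p q (- x) ≈
    x * x * ((p + - q) * (p + - q) + - (ι 3 * (p + q)) + - (ι 2 * x)) + - (p * q * ((p + q) + ι 6 * x))
  charPoly-at p q x = trans (charPoly-expand p q (- x)) (solve 3 (λ p q x →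
    (:- x) :* (:- x) :* (con (+ 2) :* :- x :+ (p :+ :- q) :* (p :+ :- q) :+ :- (con (+ 3) :* (p :+ q)))
      :+ :- (p :* q :* ((p :+ q) :+ :- (con (+ 6) :* :- x)))
    := x :* x :* ((p :+ :- q) :* (p :+ :- q) :+ :- (con (+ 3) :* (p :+ q)) :+ :- (con (+ 2) :* x))
      :+ :- (p :* q :* ((p :+ q) :+ con (+ 6) :* x))) refl p q x)

  module _ {p q : Carrier} (0≤p : 0# ≤ p) (0≤q : 0# ≤ q) where
    private
      n D : Carrier
      n = p + q
      D = (p + - q) * (p + - q)
      0≤n = +-nonneg 0≤p 0≤q
      0≤D = 0≤x² (p + - q)

    -- The function is 2x³ + 3nx² - Dx² + pq(n + 6x). The term with D decreases and is dropped,
    -- whatever the size of D; on [0, b] the others have slopes at most 6b², 6nb and 6pq. The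
    -- summand `1#` makes the constant positive in every case.
    charPoly-lipschitz : ∀ {x t u} → 0# ≤ x → 0# ≤ t → 0# ≤ u → let b = x + t + u in
      - charPoly p q (- (x + t)) ≤ - charPoly p q (- x) + (ι 6 * (b * b) + ι 6 * n * b + ι 6 * (p * q) + 1#) * t
    charPoly-lipschitz {x} {t} {u} 0≤x 0≤t 0≤u = ≤-slack
      (t * (ι 6 * x * t + ι 4 * t * t + ι 6 * u * u + ι 12 * x * u + ι 12 * t * u
            + ι 3 * n * t + ι 6 * n * u + D * (ι 2 * x + t) + 1#))
      (*-nonneg 0≤t (+-nonneg (+-nonneg (+-nonneg (+-nonneg (+-nonneg (+-nonneg (+-nonneg (+-nonneg
        (mon 6 0≤x 0≤t) (mon 4 0≤t 0≤t)) (mon 6 0≤u 0≤u)) (mon 12 0≤x 0≤u)) (mon 12 0≤t 0≤u))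
        (mon 3 0≤n 0≤t)) (mon 6 0≤n 0≤u)) (*-nonneg 0≤D (+-nonneg (*-nonneg (0≤ι 2) 0≤x) 0≤t))) (inj₁ 0<1)))
      (trans (+-congʳ (-‿cong (charPoly-at p q x))) (trans
        (solve 6 (λ p q x t u o →
          let n = p :+ q
              D = (p :+ :- q) :* (p :+ :- q)
              b = x :+ t :+ u
              F = λ x → :- (x :* x :* (D :+ :- (con (+ 3) :* n) :+ :- (con (+ 2) :* x))
                            :+ :- (p :* q :* (n :+ con (+ 6) :* x)))
          in F x :+ (con (+ 6) :* (b :* b) :+ con (+ 6) :* n :* b :+ con (+ 6) :* (p :* q) :+ o) :* t
             := F (x :+ t) :+ t :* (con (+ 6) :* x :* t :+ con (+ 4) :* t :* t :+ con (+ 6) :* u :* u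
                :+ con (+ 12) :* x :* u :+ con (+ 12) :* t :* u :+ con (+ 3) :* n :* t :+ con (+ 6) :* n :* u
                :+ D :* (con (+ 2) :* x :+ t) :+ o)) refl p q x t u 1#)
        (+-congʳ (-‿cong (sym (charPoly-at p q (x + t)))))))
      where
      mon : ∀ k {y z} → 0# ≤ y → 0# ≤ z → 0# ≤ ι k * y * z
      mon k 0≤y 0≤z = *-nonneg (*-nonneg (0≤ι k) 0≤y) 0≤z

    4pq+D≈n² : ι 4 * (p * q) + D ≈ n * n
    4pq+D≈n² = solve 2 (λ p q → con (+ 4) :* (p :* q) :+ (p :+ :- q) :* (p :+ :- q) := (p :+ q) :* (p :+ q)) refl p q

    -- At x = n + e the bracket D - 3n - 2x equals 3n, and as x ≥ n the term 3nx² outweighs pq(n +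
    -- 6x) ≤ 7n²x/4. Multiplying by 4 lets 4pq be replaced by n² - D, after which every term is
    -- visibly nonnegative.
    0≤charPoly-lo : ∀ e → 0# ≤ e → D ≈ ι 2 * (ι 4 * n + e) → 0# ≤ charPoly p q (- (n + e))
    0≤charPoly-lo e 0≤e D≈ = *-cancelˡ-≤ (0<ι 3) (≤-resp₂ (sym (zeroʳ _)) (sym (begin
      ι 4 * charPoly p q (- (n + e))
        ≈⟨ *-congˡ (trans (charPoly-at p q (n + e)) (+-congʳ (*-congˡ (+-congʳ (+-congʳ D≈))))) ⟩
      ι 4 * ((n + e) * (n + e) * (ι 2 * (ι 4 * n + e) + - (ι 3 * n) + - (ι 2 * (n + e))) + - (p * q * (n + ι 6 * (n + e))))
        ≈⟨ solve 3 (λ n e r → con (+ 4) :* ((n :+ e) :* (n :+ e) :* (con (+ 2) :* (con (+ 4) :* n :+ e) :+ :- (con (+ 3) :* n) :+ :- (con (+ 2) :* (n :+ e))) :+ :- (r :* (n :+ con (+ 6) :* (n :+ e))))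
             := con (+ 12) :* n :* ((n :+ e) :* (n :+ e)) :+ :- (con (+ 4) :* r :* (n :+ con (+ 6) :* (n :+ e)))) refl n e (p * q) ⟩
      ι 12 * n * ((n + e) * (n + e)) + - (ι 4 * (p * q) * (n + ι 6 * (n + e)))
        ≈⟨ +-congˡ (-‿cong (*-congʳ 4pq≈)) ⟩
      ι 12 * n * ((n + e) * (n + e)) + - ((n * n + - D) * (n + ι 6 * (n + e)))
        ≈⟨ solve 3 (λ n e D → con (+ 12) :* n :* ((n :+ e) :* (n :+ e)) :+ :- ((n :* n :+ :- D) :* (n :+ con (+ 6) :* (n :+ e)))
             := n :* (con (+ 5) :* (n :* n) :+ con (+ 18) :* (n :* e) :+ con (+ 12) :* (e :* e)) :+ D :* (con (+ 7) :* n :+ con (+ 6) :* e)) refl n e D ⟩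
      n * (ι 5 * (n * n) + ι 18 * (n * e) + ι 12 * (e * e)) + D * (ι 7 * n + ι 6 * e) ∎))
      (+-nonneg (*-nonneg 0≤n (+-nonneg (+-nonneg (mon 5 0≤n 0≤n) (mon 18 0≤n 0≤e)) (mon 12 0≤e 0≤e)))
                (*-nonneg 0≤D (+-nonneg (*-nonneg (0≤ι 7) 0≤n) (*-nonneg (0≤ι 6) 0≤e)))))
      where
      mon : ∀ k {y z} → 0# ≤ y → 0# ≤ z → 0# ≤ ι k * (y * z)
      mon k 0≤y 0≤z = *-nonneg (0≤ι k) (*-nonneg 0≤y 0≤z)
      4pq≈ : ι 4 * (p * q) ≈ n * n + - D
      4pq≈ = trans (solve 2 (λ x D → x := x :+ D :+ :- D) refl _ D) (+-congʳ 4pq+D≈n²)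

    -- At x = D/2 the bracket D - 3n - 2x equals -3n, so no positive term survives.
    charPoly-hi≤0 : ∀ d → 0# ≤ d → D ≈ ι 2 * d → charPoly p q (- d) ≤ 0#
    charPoly-hi≤0 d 0≤d D≈ = ≤-slack (ι 3 * n * (d * d) + p * q * (n + ι 6 * d))
      (+-nonneg (*-nonneg (*-nonneg (0≤ι 3) 0≤n) (*-nonneg 0≤d 0≤d))
                (*-nonneg (*-nonneg 0≤p 0≤q) (+-nonneg 0≤n (*-nonneg (0≤ι 6) 0≤d))))
      (sym (trans (+-congʳ (trans (charPoly-at p q d) (+-congʳ (*-congˡ (+-congʳ (+-congʳ D≈))))))
        (solve 3 (λ n d r → d :* d :* (con (+ 2) :* d :+ :- (con (+ 3) :* n) :+ :- (con (+ 2) :* d))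
             :+ :- (r :* (n :+ con (+ 6) :* d))
             :+ (con (+ 3) :* n :* (d :* d) :+ r :* (n :+ con (+ 6) :* d)) := con (+ 0)) refl n d (p * q))))

    -- Here e = D/2 - 4n, so the interval is [D/2 - 3n, D/2], where the bracket D - 3n - 2x falls
    -- from 3n to -3n. The sign is reversed to make the function rise from nonpositive to
    -- nonnegative.
    charPoly-negative-root : ∀ e → 0# ≤ e → D ≈ ι 2 * (ι 4 * n + e) →
      ∃ λ y → n + e ≤ y × y ≤ ι 4 * n + e × charPoly p q (- y) ≈ 0#
    charPoly-negative-root e 0≤e D≈ =
      let y , lo≤y , y≤hi , F≈0 = intermediate-value (λ x → - charPoly p q (- x))
            (λ x≈ → -‿cong (charPoly-cong p q (-‿cong x≈)))
            lo≤hi 0<K lipschitz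
            (neg (0≤charPoly-lo e 0≤e D≈)) (neg′ (charPoly-hi≤0 hi 0≤hi D≈))
      in y , lo≤y , y≤hi , trans (solve 1 (λ x → x := :- (:- x)) refl _) (trans (-‿cong F≈0) -0≈0)
      where
      lo = n + e
      hi = ι 4 * n + e
      0≤lo = +-nonneg 0≤n 0≤e
      0≤hi = +-nonneg (*-nonneg (0≤ι 4) 0≤n) 0≤e
      lo≤hi : lo ≤ hi
      lo≤hi = ≤-slack (ι 3 * n) (*-nonneg (0≤ι 3) 0≤n)
        (solve 2 (λ n e → con (+ 4) :* n :+ e := n :+ e :+ con (+ 3) :* n) refl n e)
      K = ι 6 * (hi * hi) + ι 6 * n * hi + ι 6 * (p * q) + 1#
      0<K : 0# < K
      0<K = ≤-<-trans (+-nonneg (+-nonneg (*-nonneg (0≤ι 6) (*-nonneg 0≤hi 0≤hi)) (*-nonneg (*-nonneg (0≤ι 6) 0≤n) 0≤hi))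
                (*-nonneg (0≤ι 6) (*-nonneg 0≤p 0≤q))) (x<x+p _ 0<1)
      -0≈0 : - 0# ≈ 0#
      -0≈0 = RingProperties.-0#≈0# ring
      neg : ∀ {x} → 0# ≤ x → - x ≤ 0#
      neg {x} 0≤x = ≤-slack x 0≤x (sym (-‿inverseˡ x))
      neg′ : ∀ {x} → x ≤ 0# → 0# ≤ - x
      neg′ {x} x≤0 = let c , 0≤c , 0≈x+c = ≤-gap x≤0 in ≤-slack c 0≤c
        (trans (sym (+-identityʳ _)) (trans (+-congˡ 0≈x+c)
          (solve 2 (λ x c → :- x :+ (x :+ c) := con (+ 0) :+ c) refl x c)))
      lipschitz : ∀ {x t} → lo ≤ x → 0# ≤ t → x + t ≤ hi →
                  - charPoly p q (- (x + t)) ≤ - charPoly p q (- x) + K * t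
      lipschitz {x} {t} lo≤x 0≤t x+t≤hi =
        let u , 0≤u , hi≈ = ≤-gap x+t≤hi
        in ≤-resp₂ refl (+-congˡ (*-congʳ (+-congʳ (+-congʳ (+-cong (*-congˡ (*-cong (sym hi≈) (sym hi≈))) (*-congˡ (sym hi≈)))))))
             (charPoly-lipschitz (≤-trans 0≤lo lo≤x) 0≤t 0≤u)

    -- Since y ≤ 7m and pq ≤ n²/4, x is at most 7n²/(4m) ≤ 7n/4. The slack polynomial does this
    -- without division, with m = n + t and 4pq = n² - D.
    root-bound : ∀ {m x y} → 0# < m → n ≤ m → m * m * x ≈ p * q * y → y ≤ n + ι 6 * m → ι 4 * x ≤ ι 7 * n
    root-bound {m} {x} {y} 0<m n≤m m²x≈pqy y≤ =
      let t , 0≤t , m≈ = ≤-gap n≤m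
      in *-cancelˡ-≤ (*-pos 0<m 0<m) (≤-trans
        (≤-resp₂ (trans (solve 3 (λ p q y → con (+ 4) :* (p :* q) :* y := con (+ 4) :* (p :* q :* y)) refl p q y)
                   (trans (*-congˡ (sym m²x≈pqy)) (solve 2 (λ m x → con (+ 4) :* (m :* m :* x) := m :* m :* (con (+ 4) :* x)) refl m x)))
                 refl (*-monoʳ-≤ (*-nonneg (0≤ι 4) (*-nonneg 0≤p 0≤q)) y≤))
        (≤-slack (ι 8 * (n * n) * t + ι 7 * n * (t * t) + D * (ι 7 * n + ι 6 * t))
          (+-nonneg (+-nonneg (*-nonneg (*-nonneg (0≤ι 8) (*-nonneg 0≤n 0≤n)) 0≤t)
                              (*-nonneg (*-nonneg (0≤ι 7) 0≤n) (*-nonneg 0≤t 0≤t)))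
                    (*-nonneg 0≤D (+-nonneg (*-nonneg (0≤ι 7) 0≤n) (*-nonneg (0≤ι 6) 0≤t))))
          (trans (*-congʳ (*-cong m≈ m≈)) (trans
            (solve 3 (λ p q t →
               let n = p :+ q
                   D = (p :+ :- q) :* (p :+ :- q)
               in (n :+ t) :* (n :+ t) :* (con (+ 7) :* n)
                  := con (+ 4) :* (p :* q) :* (n :+ con (+ 6) :* (n :+ t))
                     :+ (con (+ 8) :* (n :* n) :* t :+ con (+ 7) :* n :* (t :* t) :+ D :* (con (+ 7) :* n :+ con (+ 6) :* t))) refl p q t)
            (+-congʳ (*-congˡ (+-congˡ (*-congˡ (sym m≈)))))))))

-- Complex numbers as a normed algebra.

-- The facts about ℂ that the argument uses. Arguing in an abstract ring keeps
-- complex arithmetic from unfolding into real and imaginary parts.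
record NormedAlgebra (ℝ : CompleteOrderedField) : Set₁ where
  private module ℝ = CompleteOrderedField ℝ
  field
    commutativeRing : CommutativeRing 0ℓ 0ℓ
  open CommutativeRing commutativeRing hiding (zero) public
  infix 4 _≟_
  field
    _≟_       : Decidable _≈_
    ‖_‖       : Carrier → ℝ.Carrier
    0≤‖_‖     : ∀ z → ℝ.0# ℝ.≤ ‖ z ‖
    ‖‖-cong   : ∀ {z w} → z ≈ w → ‖ z ‖ ℝ.≈ ‖ w ‖
    ‖‖-*      : ∀ z w → ‖ z * w ‖ ℝ.≈ ‖ z ‖ ℝ.* ‖ w ‖
    ‖‖-neg    : ∀ z → ‖ - z ‖ ℝ.≈ ‖ z ‖
    ‖‖-+      : ∀ z w → ‖ z + w ‖ ℝ.≤ ‖ z ‖ ℝ.+ ‖ w ‖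
    ‖‖≈0⇒≈0   : ∀ z → ‖ z ‖ ℝ.≈ ℝ.0# → z ≈ 0#
    fromℝ      : ℝ.Carrier → Carrier
    ‖fromℝ‖    : ∀ {x} → ℝ.0# ℝ.≤ x → ‖ fromℝ x ‖ ℝ.≈ x
    fromℝ-cong : ∀ {x y} → x ℝ.≈ y → fromℝ x ≈ fromℝ y
    fromℝ-+    : ∀ x y → fromℝ (x ℝ.+ y) ≈ fromℝ x + fromℝ y
    fromℝ-*    : ∀ x y → fromℝ (x ℝ.* y) ≈ fromℝ x * fromℝ y
    fromℝ-neg  : ∀ x → fromℝ (ℝ.- x) ≈ - fromℝ x
    fromℝ-0    : fromℝ ℝ.0# ≈ 0#
    fromℝ-1    : fromℝ ℝ.1# ≈ 1#

module ComplexNumbers (ℝ : CompleteOrderedField) where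
  open Spectra ℝ
  open RealOrder ℝ hiding (charPoly-cong)
  private
    module ℝ where
      open CompleteOrderedField ℝ public
      open CommutativeRing commutativeRing public
        using (refl; sym; trans; +-cong; +-congʳ; *-cong; -‿cong; +-identityˡ; +-identityʳ; zeroʳ; zeroˡ; +-comm)
    open IntegerSolver ℝ.commutativeRing

  ℂ-isCommutativeRing : IsCommutativeRing _≈_ _+_ _*_ -_ 0# 1#
  ℂ-isCommutativeRing = record
    { isRing = record
      { +-isAbelianGroup = record
        { isGroup = record
          { isMonoid = record
            { isSemigroup = record
              { isMagma = record
                { isEquivalence = record
                  { refl  = ℝ.refl , ℝ.refl
                  ; sym   = λ (p , q) → ℝ.sym p , ℝ.sym q
                  ; trans = λ (p , q) (p′ , q′) → ℝ.trans p p′ , ℝ.trans q q′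
                  }
                ; ∙-cong = λ (p , q) (p′ , q′) → ℝ.+-cong p p′ , ℝ.+-cong q q′
                }
              ; assoc = λ (a +i b) (c +i d) (e +i f) → assoc a c e , assoc b d f
              }
            ; identity = (λ (a +i b) → ℝ.+-identityˡ a , ℝ.+-identityˡ b)
                       , (λ (a +i b) → ℝ.+-identityʳ a , ℝ.+-identityʳ b)
            }
          ; inverse = (λ (a +i b) → inverseˡ a , inverseˡ b) , (λ (a +i b) → inverseʳ a , inverseʳ b)
          ; ⁻¹-cong = λ (p , q) → ℝ.-‿cong p , ℝ.-‿cong q
          }
        ; comm = λ (a +i b) (c +i d) → ℝ.+-comm a c , ℝ.+-comm b d
        }
      ; *-cong = λ (p , q) (p′ , q′) →
          ℝ.+-cong (ℝ.*-cong p p′) (ℝ.-‿cong (ℝ.*-cong q q′)) , ℝ.+-cong (ℝ.*-cong p q′) (ℝ.*-cong q p′)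
      ; *-assoc = λ (a +i b) (c +i d) (e +i f) →
          solve 6 (λ a b c d e f → (a :* c :+ :- (b :* d)) :* e :+ :- ((a :* d :+ b :* c) :* f)
            := a :* (c :* e :+ :- (d :* f)) :+ :- (b :* (c :* f :+ d :* e))) ℝ.refl a b c d e f ,
          solve 6 (λ a b c d e f → (a :* c :+ :- (b :* d)) :* f :+ (a :* d :+ b :* c) :* e
            := a :* (c :* f :+ d :* e) :+ b :* (c :* e :+ :- (d :* f))) ℝ.refl a b c d e f
      ; *-identity = (λ (a +i b) → identityˡ a b , identityˡ′ a b) , λ (a +i b) → identityʳ a b , identityʳ′ a b
      ; distrib = (λ (a +i b) (c +i d) (e +i f) →
          solve 6 (λ a b c d e f → a :* (c :+ e) :+ :- (b :* (d :+ f))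
            := (a :* c :+ :- (b :* d)) :+ (a :* e :+ :- (b :* f))) ℝ.refl a b c d e f ,
          solve 6 (λ a b c d e f → a :* (d :+ f) :+ b :* (c :+ e)
            := (a :* d :+ b :* c) :+ (a :* f :+ b :* e)) ℝ.refl a b c d e f)
        , (λ (a +i b) (c +i d) (e +i f) →
          solve 6 (λ a b c d e f → (c :+ e) :* a :+ :- ((d :+ f) :* b)
            := (c :* a :+ :- (d :* b)) :+ (e :* a :+ :- (f :* b))) ℝ.refl a b c d e f ,
          solve 6 (λ a b c d e f → (c :+ e) :* b :+ (d :+ f) :* a
            := (c :* b :+ d :* a) :+ (e :* b :+ f :* a)) ℝ.refl a b c d e f)
      }
    ; *-comm = λ (a +i b) (c +i d) →
        solve 4 (λ a b c d → a :* c :+ :- (b :* d) := c :* a :+ :- (d :* b)) ℝ.refl a b c d ,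
        solve 4 (λ a b c d → a :* d :+ b :* c := c :* b :+ d :* a) ℝ.refl a b c d
    }
    where
    open CommutativeRing ℝ.commutativeRing using () renaming
      (+-assoc to assoc; -‿inverseˡ to inverseˡ; -‿inverseʳ to inverseʳ; *-identityˡ to 1*; *-identityʳ to *1)
    -0≈0 = RingProperties.-0#≈0# (CommutativeRing.ring ℝ.commutativeRing)
    identityˡ : ∀ a b → ℝ.1# ℝ.* a ℝ.+ ℝ.- (ℝ.0# ℝ.* b) ℝ.≈ a
    identityˡ a b = ℝ.trans (ℝ.+-cong (1* a) (ℝ.trans (ℝ.-‿cong (ℝ.zeroˡ b)) -0≈0)) (ℝ.+-identityʳ a)
    identityˡ′ : ∀ a b → ℝ.1# ℝ.* b ℝ.+ ℝ.0# ℝ.* a ℝ.≈ b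
    identityˡ′ a b = ℝ.trans (ℝ.+-cong (1* b) (ℝ.zeroˡ a)) (ℝ.+-identityʳ b)
    identityʳ : ∀ a b → a ℝ.* ℝ.1# ℝ.+ ℝ.- (b ℝ.* ℝ.0#) ℝ.≈ a
    identityʳ a b = ℝ.trans (ℝ.+-cong (*1 a) (ℝ.trans (ℝ.-‿cong (ℝ.zeroʳ b)) -0≈0)) (ℝ.+-identityʳ a)
    identityʳ′ : ∀ a b → a ℝ.* ℝ.0# ℝ.+ b ℝ.* ℝ.1# ℝ.≈ b
    identityʳ′ a b = ℝ.trans (ℝ.+-cong (ℝ.zeroʳ a) (*1 b)) (ℝ.+-identityˡ b)

  ℂ-commutativeRing : CommutativeRing 0ℓ 0ℓ
  ℂ-commutativeRing = record { isCommutativeRing = ℂ-isCommutativeRing }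

  infix 4 _≟_
  _≟_ : Decidable _≈_
  (a +i b) ≟ (c +i d) = (a ≈? c) ×-dec (b ≈? d)

  abstract
    -- A copy of ∣_∣ that hides the construction of square roots.
    ‖_‖ : ℂ → Real
    ‖ z ‖ = ∣ z ∣

    ‖‖≡∣∣ : ∀ z → ‖ z ‖ ≡ ∣ z ∣
    ‖‖≡∣∣ z = ≡.refl

    0≤‖_‖ : ∀ z → ℝ.0# ≤ℝ ‖ z ‖
    0≤‖ a +i b ‖ = proj₁ (proj₂ (ℝ.sqrt (a ℝ.* a ℝ.+ b ℝ.* b) (ℝ.0≤x²+y² a b)))

    ‖_‖² : ∀ z → ‖ z ‖ ℝ.* ‖ z ‖ ℝ.≈ ℂ.re z ℝ.* ℂ.re z ℝ.+ ℂ.im z ℝ.* ℂ.im z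
    ‖ a +i b ‖² = proj₂ (proj₂ (ℝ.sqrt (a ℝ.* a ℝ.+ b ℝ.* b) (ℝ.0≤x²+y² a b)))

  -- A nonnegative real is determined by its square, so statements about the norm become polynomial
  -- identities in real and imaginary parts.
  ‖‖-unique : ∀ z {x} → ℝ.0# ≤ℝ x → x ℝ.* x ℝ.≈ ℂ.re z ℝ.* ℂ.re z ℝ.+ ℂ.im z ℝ.* ℂ.im z → ‖ z ‖ ℝ.≈ x
  ‖‖-unique z 0≤x x²≈ = ≤-antisym
    (square-cancel-≤ 0≤x (inj₂ (ℝ.trans ‖ z ‖² (ℝ.sym x²≈))))
    (square-cancel-≤ 0≤‖ z ‖ (inj₂ (ℝ.trans x²≈ (ℝ.sym ‖ z ‖²))))

  ‖‖-cong : ∀ {z w} → z ≈ w → ‖ z ‖ ℝ.≈ ‖ w ‖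
  ‖‖-cong {z} {w} (a≈c , b≈d) = ‖‖-unique z 0≤‖ w ‖
    (ℝ.trans ‖ w ‖² (ℝ.sym (ℝ.+-cong (ℝ.*-cong a≈c a≈c) (ℝ.*-cong b≈d b≈d))))

  -- Brahmagupta's two-square identity.
  ‖‖-* : ∀ z w → ‖ z * w ‖ ℝ.≈ ‖ z ‖ ℝ.* ‖ w ‖
  ‖‖-* z@(a +i b) w@(c +i d) = ‖‖-unique (z * w) (ℝ.*-nonneg 0≤‖ z ‖ 0≤‖ w ‖) (ℝ.trans
    (solve 2 (λ x y → x :* y :* (x :* y) := x :* x :* (y :* y)) ℝ.refl ‖ z ‖ ‖ w ‖) (ℝ.trans
    (ℝ.*-cong ‖ z ‖² ‖ w ‖²)
    (solve 4 (λ a b c d → (a :* a :+ b :* b) :* (c :* c :+ d :* d)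
      := (a :* c :+ :- (b :* d)) :* (a :* c :+ :- (b :* d)) :+ (a :* d :+ b :* c) :* (a :* d :+ b :* c)) ℝ.refl a b c d)))

  ‖‖-neg : ∀ z → ‖ - z ‖ ℝ.≈ ‖ z ‖
  ‖‖-neg z@(a +i b) = ‖‖-unique (- z) 0≤‖ z ‖ (ℝ.trans ‖ z ‖²
    (solve 2 (λ a b → a :* a :+ b :* b := (:- a) :* (:- a) :+ (:- b) :* (:- b)) ℝ.refl a b))

  -- Cauchy–Schwarz: (a² + b²)(c² + d²) − (ac + bd)² = (ad − bc)².
  ‖‖-+ : ∀ z w → ‖ z + w ‖ ≤ℝ ‖ z ‖ ℝ.+ ‖ w ‖
  ‖‖-+ z@(a +i b) w@(c +i d) = square-cancel-≤ (ℝ.+-nonneg 0≤‖ z ‖ 0≤‖ w ‖)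
    (ℝ.≤-resp₂
      (ℝ.trans (ℝ.+-congʳ (ℝ.+-cong ‖ z ‖² ‖ w ‖²)) (ℝ.trans
        (solve 4 (λ a b c d → a :* a :+ b :* b :+ (c :* c :+ d :* d) :+ con (+ 2) :* (a :* c :+ b :* d)
          := (a :+ c) :* (a :+ c) :+ (b :+ d) :* (b :+ d)) ℝ.refl a b c d)
        (ℝ.sym ‖ z + w ‖²)))
      (solve 2 (λ x y → x :* x :+ y :* y :+ con (+ 2) :* (x :* y) := (x :+ y) :* (x :+ y)) ℝ.refl ‖ z ‖ ‖ w ‖)
      (+-mono-≤ (inj₂ ℝ.refl) (*-monoʳ-≤ (0≤ι 2) inner)))
    where
    inner : a ℝ.* c ℝ.+ b ℝ.* d ≤ℝ ‖ z ‖ ℝ.* ‖ w ‖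
    inner = square-cancel-≤ (ℝ.*-nonneg 0≤‖ z ‖ 0≤‖ w ‖) (≤-slack _ (ℝ.0≤x² (a ℝ.* d ℝ.+ ℝ.- (b ℝ.* c))) (ℝ.trans
      (solve 2 (λ x y → x :* y :* (x :* y) := x :* x :* (y :* y)) ℝ.refl ‖ z ‖ ‖ w ‖) (ℝ.trans
      (ℝ.*-cong ‖ z ‖² ‖ w ‖²)
      (solve 4 (λ a b c d → (a :* a :+ b :* b) :* (c :* c :+ d :* d)
        := (a :* c :+ b :* d) :* (a :* c :+ b :* d) :+ (a :* d :+ :- (b :* c)) :* (a :* d :+ :- (b :* c))) ℝ.refl a b c d))))

  ‖fromℝ‖ : ∀ {x} → ℝ.0# ≤ℝ x → ‖ fromℝ x ‖ ℝ.≈ x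
  ‖fromℝ‖ {x} 0≤x = ‖‖-unique (fromℝ x) 0≤x
    (solve 1 (λ x → x :* x := x :* x :+ con (+ 0) :* con (+ 0)) ℝ.refl x)

  ‖‖≈0⇒≈0 : ∀ z → ‖ z ‖ ℝ.≈ ℝ.0# → z ≈ 0#
  ‖‖≈0⇒≈0 z@(a +i b) ‖z‖≈0 = sq≈0 (≤-antisym (ℝ.≤-resp₂ ℝ.refl sum≈0 (ℝ.x≤x+p _ (ℝ.0≤x² b))) (ℝ.0≤x² a))
                         , sq≈0 (≤-antisym (ℝ.≤-resp₂ ℝ.refl (ℝ.trans (ℝ.+-comm _ _) sum≈0) (ℝ.x≤x+p _ (ℝ.0≤x² a))) (ℝ.0≤x² b))
    where
    sum≈0 : a ℝ.* a ℝ.+ b ℝ.* b ℝ.≈ ℝ.0#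
    sum≈0 = ℝ.trans (ℝ.sym ‖ z ‖²) (ℝ.trans (ℝ.*-cong ‖z‖≈0 ‖z‖≈0) (ℝ.zeroˡ _))
    sq≈0 : ∀ {x} → x ℝ.* x ℝ.≈ ℝ.0# → x ℝ.≈ ℝ.0#
    sq≈0 x²≈0 with *-zero-divisor-free x²≈0
    ... | inj₁ x≈0 = x≈0
    ... | inj₂ x≈0 = x≈0

  fromℝ-cong : ∀ {x y} → x ℝ.≈ y → fromℝ x ≈ fromℝ y
  fromℝ-cong x≈y = x≈y , ℝ.refl

  fromℝ-+ : ∀ x y → fromℝ (x ℝ.+ y) ≈ fromℝ x + fromℝ y
  fromℝ-+ x y = ℝ.refl , ℝ.sym (ℝ.+-identityˡ ℝ.0#)

  fromℝ-* : ∀ x y → fromℝ (x ℝ.* y) ≈ fromℝ x * fromℝ y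
  fromℝ-* x y = solve 2 (λ x y → x :* y := x :* y :+ :- (con (+ 0) :* con (+ 0))) ℝ.refl x y
              , solve 2 (λ x y → con (+ 0) := x :* con (+ 0) :+ con (+ 0) :* y) ℝ.refl x y

  fromℝ-neg : ∀ x → fromℝ (ℝ.- x) ≈ - fromℝ x
  fromℝ-neg x = ℝ.refl , ℝ.sym (RingProperties.-0#≈0# (CommutativeRing.ring ℝ.commutativeRing))

  ℂ-normedAlgebra : NormedAlgebra ℝ
  ℂ-normedAlgebra = record
    { commutativeRing = ℂ-commutativeRing
    ; _≟_        = _≟_
    ; ‖_‖        = ‖_‖
    ; 0≤‖_‖      = 0≤‖_‖
    ; ‖‖-cong    = ‖‖-cong
    ; ‖‖-*       = ‖‖-*
    ; ‖‖-neg     = ‖‖-neg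
    ; ‖‖-+       = ‖‖-+
    ; ‖‖≈0⇒≈0    = ‖‖≈0⇒≈0
    ; fromℝ      = fromℝ
    ; ‖fromℝ‖    = ‖fromℝ‖
    ; fromℝ-cong = fromℝ-cong
    ; fromℝ-+    = fromℝ-+
    ; fromℝ-*    = fromℝ-*
    ; fromℝ-neg  = fromℝ-neg
    ; fromℝ-0    = ℝ.refl , ℝ.refl
    ; fromℝ-1    = ℝ.refl , ℝ.refl
    }

-- Eigenvalues over a normed algebra, with the case of order 2.

module EigenvalueGeometry (ℝ : CompleteOrderedField) (𝔽 : NormedAlgebra ℝ) where
  private
    module ℝ where
      open CompleteOrderedField ℝ public
      open CommutativeRing commutativeRing public
        using (refl; sym; trans; +-cong; +-congˡ; +-congʳ; *-cong; *-congˡ; *-congʳ; -‿cong; zeroʳ; *-identityˡ)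
      open TwoValues commutativeRing public using (ι; form; charPoly)
      open IntegerSolver commutativeRing public
      open SemiringMult (CommutativeRing.semiring commutativeRing) public using (×-homo-+)
  open NormedAlgebra 𝔽
  open RingProperties ring using (-‿involutive) renaming (x≈y⇒x∙y⁻¹≈ε to x≈y⇒x-y≈0; x∙y⁻¹≈ε⇒x≈y to x-y≈0⇒x≈y)
  open SemiringMult semiring using (×-homo-+)
  open SemiringSum semiring using (sum)
  open TwoValues commutativeRing
  open RealOrder ℝ hiding (charPoly-cong)
  private
    module S = IntegerSolver commutativeRing
  open S using (solve; con; _:+_; _:*_; :-_; _:=_)
  open ≈-Reasoning setoid

  ‖0‖≈0 : ∀ {z} → z ≈ 0# → ‖ z ‖ ℝ.≈ ℝ.0#
  ‖0‖≈0 z≈0 = ℝ.trans (‖‖-cong (trans z≈0 (sym fromℝ-0))) (‖fromℝ‖ (inj₂ ℝ.refl))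

  -- Inherited from the reals through multiplicativity of the norm.
  zero-divisor-free : ∀ {z w} → z * w ≈ 0# → z ≈ 0# ⊎ w ≈ 0#
  zero-divisor-free {z} {w} zw≈0 = Sum.map (‖‖≈0⇒≈0 z) (‖‖≈0⇒≈0 w)
    (*-zero-divisor-free (ℝ.trans (ℝ.sym (‖‖-* z w)) (‖0‖≈0 zw≈0)))

  square-zero : ∀ {z} → z * z ≈ 0# → z ≈ 0#
  square-zero = [ id , id ]′ ∘ zero-divisor-free

  *-cancelˡ : ∀ {z w w′} → ¬ z ≈ 0# → z * w ≈ z * w′ → w ≈ w′
  *-cancelˡ {z} {w} {w′} z≉0 eq
    with zero-divisor-free {z} {w + - w′} (trans (RingProperties.x[y-z]≈xy-xz ring z w w′) (x≈y⇒x-y≈0 eq))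
  ... | inj₁ z≈0    = contradiction z≈0 z≉0
  ... | inj₂ w-w′≈0 = x-y≈0⇒x≈y _ _ w-w′≈0

  fromℝ-ι : ∀ n → fromℝ (ℝ.ι n) ≈ ι n
  fromℝ-ι zero    = fromℝ-0
  fromℝ-ι (suc n) = trans (fromℝ-+ ℝ.1# (ℝ.ι n)) (+-cong fromℝ-1 (fromℝ-ι n))

  fromℝ-sub : ∀ x y → fromℝ (x ℝ.+ ℝ.- y) ≈ fromℝ x + - fromℝ y
  fromℝ-sub x y = trans (fromℝ-+ x (ℝ.- y)) (+-congˡ (fromℝ-neg y))

  ‖ι‖ : ∀ n → ‖ ι n ‖ ℝ.≈ ℝ.ι n
  ‖ι‖ n = ℝ.trans (‖‖-cong (sym (fromℝ-ι n))) (‖fromℝ‖ (0≤ι n))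

  ‖1‖ : ‖ 1# ‖ ℝ.≈ ℝ.ι 1
  ‖1‖ = ℝ.trans (‖‖-cong (sym (+-identityʳ 1#))) (‖ι‖ 1)

  -- The balls are open, so the unit shift between the two spectra of order 2 calls for a radius
  -- above 1.
  1<2 : ℝ.ι 1 ℝ.< ℝ.ι 2 ℝ.* ℝ.ι 1
  1<2 = ℝ.<-resp₂ ℝ.refl (ℝ.solve 0 (ℝ.con (+ 1) ℝ.:+ ℝ.con (+ 1) ℝ.:= ℝ.con (+ 2) ℝ.:* ℝ.con (+ 1)) ℝ.refl) (ℝ.x<x+p _ (0<ι 0))

  add-one-near : ∀ z → ‖ z + 1# + - z ‖ ℝ.< ℝ.ι 2 ℝ.* ℝ.ι 1
  add-one-near z = ℝ.<-resp₂ (ℝ.sym (ℝ.trans (‖‖-cong (solve 2 (λ z o → z :+ o :+ :- z := o) refl z 1#)) ‖1‖)) ℝ.refl 1<2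

  subtract-one-near : ∀ z → ‖ z + - 1# + - z ‖ ℝ.< ℝ.ι 2 ℝ.* ℝ.ι 1
  subtract-one-near z = ℝ.<-resp₂ (ℝ.sym (ℝ.trans (‖‖-cong (solve 2 (λ z o → z :+ :- o :+ :- z := :- o) refl z 1#))
    (ℝ.trans (‖‖-neg 1#) ‖1‖))) ℝ.refl 1<2

  fromℝ≈0⇒≮ : ∀ {x} → fromℝ x ≈ 0# → ¬ ℝ.0# ℝ.< x
  fromℝ≈0⇒≮ {x} x̂≈0 0<x = irrefl (ℝ.trans (ℝ.sym (‖0‖≈0 x̂≈0)) (‖fromℝ‖ (inj₁ 0<x))) 0<x

  ι≉0 : ∀ n → ¬ ι (suc n) ≈ 0#
  ι≉0 n eq = fromℝ≈0⇒≮ (trans (fromℝ-ι (suc n)) eq) (0<ι n)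

  1≉0 : ¬ 1# ≈ 0#
  1≉0 eq = ι≉0 0 (trans (+-identityʳ 1#) eq)

  -- The roots are found in the reals, while the eigenvectors built from them have entries in `𝔽`.
  charPoly-fromℝ : ∀ p q μ → charPoly (fromℝ p) (fromℝ q) (fromℝ μ) ≈ fromℝ (ℝ.charPoly p q μ)
  charPoly-fromℝ p q μ = trans (form-cong (sym (fromℝ-sub q μ)) (sym (fromℝ-sub μ p)))
    (form-fromℝ (q ℝ.+ ℝ.- μ) (μ ℝ.+ ℝ.- p))
    where
    infixl 6 _⊕_
    infixl 7 _⊗_
    _⊕_ : ∀ {x y z w} → fromℝ x ≈ z → fromℝ y ≈ w → fromℝ (x ℝ.+ y) ≈ z + w
    x≈ ⊕ y≈ = trans (fromℝ-+ _ _) (+-cong x≈ y≈)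
    _⊗_ : ∀ {x y z w} → fromℝ x ≈ z → fromℝ y ≈ w → fromℝ (x ℝ.* y) ≈ z * w
    x≈ ⊗ y≈ = trans (fromℝ-* _ _) (*-cong x≈ y≈)
    ⊖_ : ∀ {x z} → fromℝ x ≈ z → fromℝ (ℝ.- x) ≈ - z
    ⊖ x≈ = trans (fromℝ-neg _) (-‿cong x≈)
    form-fromℝ : ∀ a b → form (fromℝ p) (fromℝ q) (fromℝ μ) (fromℝ a) (fromℝ b) ≈ fromℝ (ℝ.form p q μ a b)
    form-fromℝ a b = sym (lin ⊗ lin ⊕ (⊖ (refl ⊗ (refl ⊗ refl))) ⊕ (⊖ (refl ⊗ (refl ⊗ refl)))
                          ⊕ (⊖ (fromℝ-ι 2 ⊗ refl ⊗ (refl ⊗ refl))))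
      where
      lin : fromℝ (p ℝ.* a ℝ.+ q ℝ.* b) ≈ fromℝ p * fromℝ a + fromℝ q * fromℝ b
      lin = refl ⊗ refl ⊕ refl ⊗ refl

  private variable n : ℕ

  NonZero : Vector Carrier n → Set
  NonZero v = ¬ (∀ i → v i ≈ 0#)

  nonZero-entry : (v : Vector Carrier n) → NonZero v → ∃ λ i → ¬ v i ≈ 0#
  nonZero-entry {n} v = Finₚ.¬∀⟶∃¬ n _ (λ i → v i ≟ 0#)

  nonZero-twoValued : ∀ p q {a b} → 1 ℕ.≤ p ℕ.+ q → ¬ a ≈ 0# → ¬ b ≈ 0# → NonZero (twoValued p q a b)
  nonZero-twoValued (suc p) q       _ a≉0 b≉0 v≈0 = a≉0 (v≈0 zero)
  nonZero-twoValued zero    (suc q) _ a≉0 b≉0 v≈0 = b≉0 (v≈0 zero)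

  -- This and its order 3 counterpart are spelled as the general definition unfolds, factors `1#`
  -- included, so that over ℂ the two agree definitionally.
  IsEigenvalue₂ : (Fin n → Fin n → Carrier) → Carrier → Set
  IsEigenvalue₂ {n} A z = ∃ λ (v : Vector Carrier n) → NonZero v ×
    ∀ i → sum {n} (λ j → A i j * (v j * 1#)) ≈ z * (v i * 1#)

  IsEigenvalue₃ : (Fin n → Fin n → Fin n → Carrier) → Carrier → Set
  IsEigenvalue₃ {n} A z = ∃ λ (v : Vector Carrier n) → NonZero v ×
    ∀ i → sum {n} (λ j → sum {n} (λ l → A i j l * (v j * (v l * 1#)))) ≈ z * (v i * (v i * 1#))

  n-full₂ : ∀ {h} → h ≈ 1# → 1 ℕ.≤ n → IsEigenvalue₂ {n} (λ _ _ → h * 1#) (ι n)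
  n-full₂ {n = suc m} {h} h≈1 _ = (λ _ → 1#) , (λ 1≈0 → 1≉0 (1≈0 zero)) , λ i → begin
    sum {suc m} (λ _ → h * 1# * (1# * 1#))   ≈⟨ sum-constantEntries {suc m} h (λ _ → 1#) ⟩
    h * sum {suc m} (λ _ → 1#)               ≈⟨ *-cong h≈1 (sum-const (suc m) 1#) ⟩
    1# * (ι (suc m) * 1#)                    ≈⟨ *-identityˡ _ ⟩
    ι (suc m) * 1#                           ≈⟨ *-congˡ (*-identityʳ 1#) ⟨
    ι (suc m) * (1# * 1#)                    ∎

  module _ {h : Carrier} (h≈1 : h ≈ 1#) (c : Fin n → Fin n → Bool)
           (on : ∀ {i j} → ¬ j ≡ i → c i j ≡ true) (off : ∀ i → c i i ≡ false) where

    complete₂-row : ∀ (v : Vector Carrier n) i →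
      sum {n} (λ j → (if c i j then h else 0#) * (v j * 1#)) + v i ≈ sum {n} (λ j → h * 1# * (v j * 1#))
    complete₂-row v i = trans (+-congˡ (sym (trans (*-congʳ h≈1) (*-identityˡ _))))
      (trans (sum-distinctEntries {c = c i} h v i on (off i)) (sym (sum-constantEntries h v)))

    full⇒complete₂ : ∀ {z} → IsEigenvalue₂ {n} (λ _ _ → h * 1#) z →
                     IsEigenvalue₂ (λ i j → if c i j then h else 0#) (z + - 1#)
    full⇒complete₂ {z} (v , v≉0 , eigen) = v , v≉0 , λ i → begin
      row v i                              ≈⟨ trans (sym (+-identityʳ _)) (trans (+-congˡ (sym (-‿inverseʳ (v i)))) (sym (+-assoc _ _ _))) ⟩
      row v i + v i + - v i                ≈⟨ +-congʳ (trans (complete₂-row v i) (eigen i)) ⟩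
      z * (v i * 1#) + - v i               ≈⟨ +-congˡ (-‿cong (trans (sym (*-identityʳ _)) (sym (*-identityˡ _)))) ⟩
      z * (v i * 1#) + - (1# * (v i * 1#)) ≈⟨ RingProperties.[y-z]x≈yx-zx ring _ z 1# ⟨
      (z + - 1#) * (v i * 1#)              ∎
      where
      row : Vector Carrier n → Fin n → Carrier
      row v i = sum {n} (λ j → (if c i j then h else 0#) * (v j * 1#))

    complete⇒full₂ : ∀ {z} → IsEigenvalue₂ (λ i j → if c i j then h else 0#) z →
                     IsEigenvalue₂ {n} (λ _ _ → h * 1#) (z + 1#)
    complete⇒full₂ {z} (v , v≉0 , eigen) = v , v≉0 , λ i →
      trans (sym (complete₂-row v i)) (trans (+-cong (eigen i) (trans (sym (*-identityʳ _)) (sym (*-identityˡ _))))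
        (sym (distribʳ (v i * 1#) z 1#)))

  -- Eigenvalue equations of order 3 through power sums.

  module _ (½ : ℝ.Carrier) (½*2≈1 : ½ ℝ.* ℝ.ι 2 ℝ.≈ ℝ.1#) where

    h : Carrier
    h = fromℝ ½

    h*2≈1 : h * ι 2 ≈ 1#
    h*2≈1 = trans (*-congˡ (sym (fromℝ-ι 2))) (trans (sym (fromℝ-* _ _)) (trans (fromℝ-cong ½*2≈1) fromℝ-1))

    0≤½ : ℝ.0# ℝ.≤ ½
    0≤½ = *-cancelˡ-≤ (0<ι 1) (ℝ.≤-resp₂ (ℝ.sym (ℝ.zeroʳ _))
      (ℝ.trans (ℝ.sym ½*2≈1) (ℝ.solve 1 (λ x → x ℝ.:* ℝ.con (+ 2) ℝ.:= ℝ.con (+ 2) ℝ.:* x) ℝ.refl ½)) (inj₁ ℝ.0<1))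

    halve : ∀ {x y} → ι 2 * x ≈ y → x ≈ h * y
    halve {x} {y} eq = sym (trans (*-congˡ (sym eq)) (trans (sym (*-assoc _ _ _)) (trans (*-congʳ h*2≈1) (*-identityˡ x))))

    double : ∀ {x y} → x ≈ h * y → ι 2 * x ≈ y
    double {x} {y} eq = trans (*-congˡ eq) (trans (sym (*-assoc _ _ _))
      (trans (*-congʳ (trans (*-comm _ _) h*2≈1)) (*-identityˡ y)))

    IsFullEigenvalue IsCompleteEigenvalue : ℕ → Carrier → Set
    IsFullEigenvalue n z =
      ∃ λ (v : Vector Carrier n) → NonZero v × ∀ i → h * (sum v * sum v) ≈ z * (v i * v i)
    IsCompleteEigenvalue n z =
      ∃ λ (v : Vector Carrier n) → NonZero v ×
        ∀ i → e₂ h v + - (sum v * v i) + v i * v i ≈ z * (v i * v i)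

    eigenvalue₃⇒full : ∀ {z} → IsEigenvalue₃ {n} (λ _ _ _ → h * 1#) z → IsFullEigenvalue n z
    eigenvalue₃⇒full (v , v≉0 , eigen) = v , v≉0 , λ i →
      trans (sym (sum-constantEntries₂ h v)) (trans (eigen i) (*-congˡ (*-congˡ (*-identityʳ _))))

    full⇒eigenvalue₃ : ∀ {z} → IsFullEigenvalue n z → IsEigenvalue₃ {n} (λ _ _ _ → h * 1#) z
    full⇒eigenvalue₃ (v , v≉0 , eigen) = v , v≉0 , λ i →
      trans (sum-constantEntries₂ h v) (trans (eigen i) (*-congˡ (*-congˡ (sym (*-identityʳ _)))))

    module _ (c : Fin n → Fin n → Fin n → Bool)
             (on : ∀ {i j l} → ¬ j ≡ i → ¬ l ≡ i → ¬ l ≡ j → c i j l ≡ true)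
             (off₁ : ∀ i l → c i i l ≡ false) (off₂ : ∀ i j → c i j i ≡ false) (off₃ : ∀ i j → c i j j ≡ false) where

      complete₃-row : ∀ (v : Vector Carrier n) i →
        sum {n} (λ j → sum {n} (λ l → (if c i j l then h else 0#) * (v j * (v l * 1#)))) ≈ e₂ h v + - (sum v * v i) + v i * v i
      complete₃-row v i = sum-distinctEntries₂ {c = c i} h*2≈1 v i on (off₁ i) (off₂ i) (off₃ i)

      eigenvalue₃⇒complete : ∀ {z} → IsEigenvalue₃ (λ i j l → if c i j l then h else 0#) z → IsCompleteEigenvalue n z
      eigenvalue₃⇒complete (v , v≉0 , eigen) = v , v≉0 , λ i →
        trans (sym (complete₃-row v i)) (trans (eigen i) (*-congˡ (*-congˡ (*-identityʳ _))))

      complete⇒eigenvalue₃ : ∀ {z} → IsCompleteEigenvalue n z → IsEigenvalue₃ (λ i j l → if c i j l then h else 0#) z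
      complete⇒eigenvalue₃ (v , v≉0 , eigen) = v , v≉0 , λ i →
        trans (complete₃-row v i) (trans (eigen i) (*-congˡ (*-congˡ (sym (*-identityʳ _)))))

    -- The spectrum of the scaled all-ones hypermatrix of order 3.

    D : ℕ → ℕ → ℝ.Carrier
    D p q = (ℝ.ι p ℝ.+ ℝ.- ℝ.ι q) ℝ.* (ℝ.ι p ℝ.+ ℝ.- ℝ.ι q)

    0≤D : ∀ p q → ℝ.0# ℝ.≤ D p q
    0≤D p q = ℝ.0≤x² _

    D̂≈ : ∀ p q → fromℝ (D p q) ≈ (ι p + - ι q) * (ι p + - ι q)
    D̂≈ p q = trans (fromℝ-* _ _) (*-cong diff diff)
      where
      diff : fromℝ (ℝ.ι p ℝ.+ ℝ.- ℝ.ι q) ≈ ι p + - ι q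
      diff = trans (fromℝ-sub _ _) (+-cong (fromℝ-ι p) (-‿cong (fromℝ-ι q)))

    center : ℕ → ℕ → Carrier
    center p q = fromℝ (½ ℝ.* D p q)

    center≈ : ∀ p q → center p q ≈ h * ((ι p + - ι q) * (ι p + - ι q))
    center≈ p q = trans (fromℝ-* _ _) (*-congˡ (D̂≈ p q))

    ‖center‖ : ∀ p q → ‖ center p q ‖ ℝ.≈ ½ ℝ.* D p q
    ‖center‖ p q = ‖fromℝ‖ (ℝ.*-nonneg 0≤½ (0≤D p q))

    center-full : ∀ p q → 1 ℕ.≤ p ℕ.+ q → IsFullEigenvalue (p ℕ.+ q) (center p q)
    center-full p q 1≤n = v , nonZero-twoValued p q 1≤n 1≉0 (1≉0 ∘ λ -1≈0 → trans (sym (-‿involutive 1#)) (trans (-‿cong -1≈0) (RingProperties.-0#≈0# ring))) , eq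
      where
      v = twoValued p q 1# (- 1#)
      s≈ : sum v ≈ ι p + - ι q
      s≈ = trans (twoValued-sum p q 1# (- 1#) id)
        (+-cong (*-identityʳ _) (trans (sym (RingProperties.-‿distribʳ-* ring _ _)) (-‿cong (*-identityʳ _))))
      v²≈1 : ∀ i → v i * v i ≈ 1#
      v²≈1 i with twoValued-values p q 1# (- 1#) i
      ... | inj₁ eq = trans (*-cong (reflexive eq) (reflexive eq)) (*-identityˡ 1#)
      ... | inj₂ eq = trans (*-cong (reflexive eq) (reflexive eq))
        (trans (solve 1 (λ o → (:- o) :* (:- o) := o :* o) refl 1#) (*-identityˡ 1#))
      eq : ∀ i → h * (sum v * sum v) ≈ center p q * (v i * v i)
      eq i = begin
        h * (sum v * sum v)                      ≈⟨ *-congˡ (*-cong s≈ s≈) ⟩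
        h * ((ι p + - ι q) * (ι p + - ι q))      ≈⟨ center≈ p q ⟨
        center p q                               ≈⟨ *-identityʳ _ ⟨
        center p q * 1#                          ≈⟨ *-congˡ (v²≈1 i) ⟨
        center p q * (v i * v i)                 ∎

    full-cases : ∀ {z} → IsFullEigenvalue n z → z ≈ 0# ⊎ ∃₂ λ p q → p ℕ.+ q ≡ n × z ≈ center p q
    full-cases {z = z} (v , v≉0 , eigen) with z ≟ 0#
    -- For z = 0 the equations say only that s = 0, and the entries need not agree up to sign.
    ... | yes z≈0 = inj₁ z≈0
    ... | no z≉0 with nonZero-entry v v≉0
    ... | k , c≉0 = inj₂ (p , q , p+q≡n , trans z≈ (sym (center≈ p q)))
      where
      c = v k
      signs : ∀ i → v i ≈ c ⊎ v i ≈ - c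
      signs i = Sum.map (x-y≈0⇒x≈y _ _) (λ eq → x-y≈0⇒x≈y _ _ (trans (+-congˡ (-‿involutive c)) eq))
        (zero-divisor-free (begin
          (v i + - c) * (v i + c)   ≈⟨ solve 2 (λ x c → (x :+ :- c) :* (x :+ c) := x :* x :+ :- (c :* c)) refl (v i) c ⟩
          v i * v i + - (c * c)     ≈⟨ x≈y⇒x-y≈0 (*-cancelˡ z≉0 (trans (sym (eigen i)) (eigen k))) ⟩
          0#                        ∎))
      counts = sum-twoValued v signs
      p = proj₁ counts
      q = proj₁ (proj₂ counts)
      p+q≡n = proj₁ (proj₂ (proj₂ counts))
      s≈ : sum v ≈ ι p * c + ι q * - c
      s≈ = proj₂ (proj₂ (proj₂ counts)) id id
      z≈ : z ≈ h * ((ι p + - ι q) * (ι p + - ι q))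
      z≈ = *-cancelˡ (c≉0 ∘ square-zero) (begin
        c * c * z                                ≈⟨ *-comm _ _ ⟩
        z * (c * c)                              ≈⟨ eigen k ⟨
        h * (sum v * sum v)                      ≈⟨ *-congˡ (*-cong s≈ s≈) ⟩
        h * ((ι p * c + ι q * - c) * (ι p * c + ι q * - c))
          ≈⟨ solve 4 (λ h p q c → h :* ((p :* c :+ q :* :- c) :* (p :* c :+ q :* :- c))
               := c :* c :* (h :* ((p :+ :- q) :* (p :+ :- q)))) refl h (ι p) (ι q) c ⟩
        c * c * (h * ((ι p + - ι q) * (ι p + - ι q))) ∎)

    -- The spectrum of the complete 3-uniform hypergraph.

    eigen⇒quadratic : ∀ {z s e x} → e + - (s * x) + x * x ≈ z * (x * x) → quadratic (1# + - z) s e x ≈ 0#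
    eigen⇒quadratic {z} {s} {e} {x} eq = begin
      (1# + - z) * (x * x) + - (s * x) + e
        ≈⟨ solve 5 (λ o z s e x → (o :+ :- z) :* (x :* x) :+ :- (s :* x) :+ e
             := e :+ :- (s :* x) :+ o :* (x :* x) :+ :- (z :* (x :* x))) refl 1# z s e x ⟩
      e + - (s * x) + 1# * (x * x) + - (z * (x * x)) ≈⟨ +-congʳ (+-congˡ (*-identityˡ _)) ⟩
      e + - (s * x) + x * x + - (z * (x * x))        ≈⟨ x≈y⇒x-y≈0 eq ⟩
      0# ∎

    quadratic⇒eigen : ∀ {μ s e x} → quadratic μ s e x ≈ 0# → e + - (s * x) + x * x ≈ (1# + - μ) * (x * x)
    quadratic⇒eigen {μ} {s} {e} {x} eq = begin
      e + - (s * x) + x * x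
        ≈⟨ solve 4 (λ μ s e x → e :+ :- (s :* x) :+ x :* x
             := (μ :* (x :* x) :+ :- (s :* x) :+ e) :+ (x :* x :+ :- μ :* (x :* x))) refl μ s e x ⟩
      quadratic μ s e x + (x * x + - μ * (x * x))    ≈⟨ +-cong eq (+-congʳ (sym (*-identityˡ _))) ⟩
      0# + (1# * (x * x) + - μ * (x * x))            ≈⟨ +-identityˡ _ ⟩
      1# * (x * x) + - μ * (x * x)                   ≈⟨ distribʳ _ _ _ ⟨
      (1# + - μ) * (x * x) ∎

    zero-complete : 1 ℕ.≤ n → IsCompleteEigenvalue n 0#
    zero-complete {n = suc q} _ = v , (λ v≈0 → 1≉0 (v≈0 zero)) , eq
      where
      v = twoValued 1 q 1# 0#
      s≈1 : sum v ≈ 1#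
      s≈1 = trans (twoValued-sum 1 q 1# 0# id)
        (trans (+-cong (trans (*-identityʳ _) (+-identityʳ _)) (zeroʳ _)) (+-identityʳ _))
      Q≈1 : sum (λ i → v i * v i) ≈ 1#
      Q≈1 = trans (twoValued-sum 1 q 1# 0# (λ x → x * x))
        (trans (+-cong (trans (*-cong (+-identityʳ _) (*-identityˡ _)) (*-identityˡ _)) (trans (*-congˡ (zeroˡ _)) (zeroʳ _))) (+-identityʳ _))
      e≈0 : e₂ h v ≈ 0#
      e≈0 = trans (*-congˡ (x≈y⇒x-y≈0 (trans (*-cong s≈1 s≈1) (trans (*-identityˡ _) (sym Q≈1))))) (zeroʳ h)
      idem : ∀ i → v i * v i ≈ v i
      idem i with twoValued-values 1 q 1# 0# i
      ... | inj₁ eq = trans (*-cong (reflexive eq) (reflexive eq)) (trans (*-identityˡ 1#) (reflexive (≡.sym eq)))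
      ... | inj₂ eq = trans (*-cong (reflexive eq) (reflexive eq)) (trans (zeroˡ 0#) (reflexive (≡.sym eq)))
      eq : ∀ i → e₂ h v + - (sum v * v i) + v i * v i ≈ 0# * (v i * v i)
      eq i = begin
        e₂ h v + - (sum v * v i) + v i * v i ≈⟨ +-cong (trans (+-cong e≈0 (-‿cong (trans (*-congʳ s≈1) (*-identityˡ _)))) (+-identityˡ _)) (idem i) ⟩
        - v i + v i       ≈⟨ -‿inverseˡ _ ⟩
        0#                ≈⟨ zeroˡ _ ⟨
        0# * (v i * v i)  ∎

    -- The values a = q + y and b = -(p + y) satisfy the first Vieta relation identically, and the
    -- root condition supplies the second. As y > 0, neither value vanishes, even when p or q is 0.
    negative-root-complete : ∀ p q {y} → 1 ℕ.≤ p ℕ.+ q → ℝ.0# ℝ.< y → ℝ.charPoly (ℝ.ι p) (ℝ.ι q) (ℝ.- y) ℝ.≈ ℝ.0# →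
                             IsCompleteEigenvalue (p ℕ.+ q) (1# + - fromℝ (ℝ.- y))
    negative-root-complete p q {y} 1≤n 0<y root = v , nonZero-twoValued p q 1≤n a≉0 b≉0 , λ i → quadratic⇒eigen (roots i)
      where
      μ a b : Carrier
      μ = fromℝ (ℝ.- y)
      a = ι q + - μ
      b = μ + - ι p
      v = twoValued p q a b
      a≉0 : ¬ a ≈ 0#
      a≉0 a≈0 = fromℝ≈0⇒≮ (trans (fromℝ-sub _ _) (trans (+-congʳ (fromℝ-ι q)) a≈0))
        (ℝ.≤-<-trans (0≤ι q) (ℝ.<-resp₂ ℝ.refl (ℝ.+-congˡ (ℝ.solve 1 (λ y → y ℝ.:= ℝ.:- (ℝ.:- y)) ℝ.refl y)) (ℝ.x<x+p _ 0<y)))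
      b≉0 : ¬ b ≈ 0#
      b≉0 b≈0 = fromℝ≈0⇒≮ (trans (fromℝ-+ (ℝ.ι p) y) (begin
          fromℝ (ℝ.ι p) + fromℝ y    ≈⟨ +-cong (trans (fromℝ-ι p) (sym (-‿involutive _))) (trans (sym (-‿involutive _)) (-‿cong (sym (fromℝ-neg y)))) ⟩
          - (- ι p) + - μ            ≈⟨ solve 2 (λ x m → :- x :+ :- m := :- (m :+ x)) refl (- ι p) μ ⟩
          - b                        ≈⟨ -‿cong b≈0 ⟩
          - 0#                       ≈⟨ RingProperties.-0#≈0# ring ⟩
          0#                         ∎))
        (ℝ.≤-<-trans (0≤ι p) (ℝ.x<x+p _ 0<y))
      form≈0 : form (ι p) (ι q) μ a b ≈ 0#
      -- `charPoly` is `form` at exactly these a and b, so the chain may start from it by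
      -- definition.
      form≈0 = begin
        charPoly (ι p) (ι q) μ                                ≈⟨ charPoly-cong (sym (fromℝ-ι p)) (sym (fromℝ-ι q)) ⟩
        charPoly (fromℝ (ℝ.ι p)) (fromℝ (ℝ.ι q)) μ            ≈⟨ charPoly-fromℝ _ _ _ ⟩
        fromℝ (ℝ.charPoly (ℝ.ι p) (ℝ.ι q) (ℝ.- y))            ≈⟨ fromℝ-cong root ⟩
        fromℝ ℝ.0#                                            ≈⟨ fromℝ-0 ⟩
        0# ∎
        where
        charPoly-cong : ∀ {p p′ q q′} → p ≈ p′ → q ≈ q′ → charPoly p q μ ≈ charPoly p′ q′ μ
        charPoly-cong {p} {p′} {q} {q′} p≈ q≈ = trans (charPoly-expand p q μ) (trans (+-cong
          (*-congˡ (+-cong (+-congˡ (*-cong (+-cong p≈ (-‿cong q≈)) (+-cong p≈ (-‿cong q≈)))) (-‿cong (*-congˡ (+-cong p≈ q≈)))))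
          (-‿cong (*-cong (*-cong p≈ q≈) (+-congʳ (+-cong p≈ q≈)))))
          (sym (charPoly-expand p′ q′ μ)))
      s≈ : sum v ≈ ι p * a + ι q * b
      s≈ = twoValued-sum p q a b id
      Q≈ : sum (λ i → v i * v i) ≈ ι p * (a * a) + ι q * (b * b)
      Q≈ = twoValued-sum p q a b (λ x → x * x)
      vieta-s : μ * (a + b) ≈ sum v
      vieta-s = trans (solve 3 (λ p q m → m :* ((q :+ :- m) :+ (m :+ :- p)) := p :* (q :+ :- m) :+ q :* (m :+ :- p)) refl (ι p) (ι q) μ) (sym s≈)
      vieta-e : μ * (a * b) ≈ e₂ h v
      vieta-e = trans (halve (begin
        ι 2 * (μ * (a * b))  ≈⟨ +-identityˡ _ ⟨
        0# + ι 2 * (μ * (a * b))  ≈⟨ +-congʳ form≈0 ⟨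
        form (ι p) (ι q) μ a b + ι 2 * (μ * (a * b))
          ≈⟨ solve 5 (λ p q m a b → (p :* a :+ q :* b) :* (p :* a :+ q :* b) :+ :- (p :* (a :* a)) :+ :- (q :* (b :* b))
                :+ :- (con (+ 2) :* m :* (a :* b)) :+ con (+ 2) :* (m :* (a :* b))
              := (p :* a :+ q :* b) :* (p :* a :+ q :* b) :+ :- (p :* (a :* a) :+ q :* (b :* b))) refl (ι p) (ι q) μ a b ⟩
        (ι p * a + ι q * b) * (ι p * a + ι q * b) + - (ι p * (a * a) + ι q * (b * b)) ∎))
        (*-congˡ (+-cong (*-cong (sym s≈) (sym s≈)) (-‿cong (sym Q≈))))
      roots : ∀ i → quadratic μ (sum v) (e₂ h v) (v i) ≈ 0#
      roots i = trans (quadratic-factors vieta-s vieta-e (v i)) (trans (*-congˡ (factor (twoValued-values p q a b i))) (zeroʳ μ))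
        where
        factor : v i ≡ a ⊎ v i ≡ b → (v i + - a) * (v i + - b) ≈ 0#
        factor (inj₁ eq) = trans (*-congʳ (x≈y⇒x-y≈0 (reflexive eq))) (zeroˡ _)
        factor (inj₂ eq) = trans (*-congˡ (x≈y⇒x-y≈0 (reflexive eq))) (zeroʳ _)

    data CompleteCases (n : ℕ) (z : Carrier) : Set where
      one      : z ≈ 1# → CompleteCases n z
      constant : ι 2 * z ≈ ι n * ι n + - (ι 3 * ι n) + ι 2 → CompleteCases n z
      root     : ∀ p q → p ℕ.+ q ≡ n → charPoly (ι p) (ι q) (1# + - z) ≈ 0# → CompleteCases n z

    module _ {z : Carrier} (v : Vector Carrier n)
      (eigen : ∀ i → e₂ h v + - (sum v * v i) + v i * v i ≈ z * (v i * v i)) where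

      private
        μ : Carrier
        μ = 1# + - z

      constant-eigenvector : ∀ k → ¬ v k ≈ 0# → (∀ i → v i ≈ v k) →
        ι 2 * z ≈ ι n * ι n + - (ι 3 * ι n) + ι 2
      constant-eigenvector k a≉0 v≈a = *-cancelˡ (a≉0 ∘ square-zero) (begin
        a * a * (ι 2 * z)          ≈⟨ solve 2 (λ a z → a :* a :* (con (+ 2) :* z) := con (+ 2) :* (z :* (a :* a))) refl a z ⟩
        ι 2 * (z * (a * a))        ≈⟨ *-congˡ (eigen k) ⟨
        ι 2 * (e₂ h v + - (sum v * a) + a * a)
          ≈⟨ solve 3 (λ e s a → con (+ 2) :* (e :+ :- (s :* a) :+ a :* a) := con (+ 2) :* e :+ con (+ 2) :* (:- (s :* a) :+ a :* a)) refl _ (sum v) a ⟩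
        ι 2 * e₂ h v + ι 2 * (- (sum v * a) + a * a)
          ≈⟨ +-cong (trans (double refl) (+-cong (*-cong s≈ s≈) (-‿cong Q≈))) (*-congˡ (+-congʳ (-‿cong (*-congʳ s≈)))) ⟩
        ι n * a * (ι n * a) + - (ι n * (a * a)) + ι 2 * (- (ι n * a * a) + a * a)
          ≈⟨ solve 2 (λ n a → n :* a :* (n :* a) :+ :- (n :* (a :* a)) :+ con (+ 2) :* (:- (n :* a :* a) :+ a :* a)
                := a :* a :* (n :* n :+ :- (con (+ 3) :* n) :+ con (+ 2))) refl (ι n) a ⟩
        a * a * (ι n * ι n + - (ι 3 * ι n) + ι 2) ∎)
        where
        a = v k
        s≈ : sum v ≈ ι n * a
        s≈ = trans (SemiringSum.sum-cong-≋ semiring {n} v≈a) (sum-const n a)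
        Q≈ : sum (λ i → v i * v i) ≈ ι n * (a * a)
        Q≈ = trans (SemiringSum.sum-cong-≋ semiring {n} (λ i → *-cong (v≈a i) (v≈a i))) (sum-const n (a * a))

      vieta : ∀ {k l} → ¬ v l ≈ v k → μ * (v k + v l) ≈ sum v × μ * (v k * v l) ≈ e₂ h v
      vieta {k} {l} b≉a = vieta-s , quadratic-root⇒vieta-product {b = v l} vieta-s (roots k)
        where
        roots : ∀ i → quadratic μ (sum v) (e₂ h v) (v i) ≈ 0#
        roots i = eigen⇒quadratic {s = sum v} (eigen i)
        vieta-s : μ * (v k + v l) ≈ sum v
        vieta-s = [ (λ a-b≈0 → contradiction (sym (x-y≈0⇒x≈y _ _ a-b≈0)) b≉a) , x-y≈0⇒x≈y _ _ ]′
          (zero-divisor-free (vieta-sum {μ} {sum v} {e₂ h v} (roots k) (roots l)))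

      two-values : ∀ {a b} → ¬ μ ≈ 0# → μ * (a + b) ≈ sum v → μ * (a * b) ≈ e₂ h v → ∀ i → v i ≈ a ⊎ v i ≈ b
      two-values {a} {b} μ≉0 vieta-s vieta-e i =
        [ (λ μ≈0 → contradiction μ≈0 μ≉0) , Sum.map (x-y≈0⇒x≈y _ _) (x-y≈0⇒x≈y _ _) ∘ zero-divisor-free ]′
          (zero-divisor-free (trans (sym (quadratic-factors {μ} {sum v} {e₂ h v} vieta-s vieta-e (v i)))
                                    (eigen⇒quadratic {s = sum v} (eigen i))))

      form-vieta : ∀ {p q a b} → sum v ≈ p * a + q * b → sum (λ i → v i * v i) ≈ p * (a * a) + q * (b * b) →
                   μ * (a * b) ≈ e₂ h v → form p q μ a b ≈ 0#
      form-vieta {p} {q} {a} {b} s≈ Q≈ vieta-e = begin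
        form p q μ a b
          ≈⟨ solve 5 (λ p q m a b → (p :* a :+ q :* b) :* (p :* a :+ q :* b) :+ :- (p :* (a :* a)) :+ :- (q :* (b :* b))
                :+ :- (con (+ 2) :* m :* (a :* b))
              := ((p :* a :+ q :* b) :* (p :* a :+ q :* b) :+ :- (p :* (a :* a) :+ q :* (b :* b))) :+ :- (con (+ 2) :* (m :* (a :* b)))) refl p q μ a b ⟩
        (p * a + q * b) * (p * a + q * b) + - (p * (a * a) + q * (b * b)) + - (ι 2 * (μ * (a * b)))
          ≈⟨ +-cong (+-cong (*-cong s≈ s≈) (-‿cong Q≈)) (-‿cong (*-congˡ (sym vieta-e))) ⟨
        sum v * sum v + - sum (λ i → v i * v i) + - (ι 2 * e₂ h v)
          ≈⟨ x≈y⇒x-y≈0 (sym (double refl)) ⟩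
        0# ∎

      nonconstant-eigenvector : ∀ k l → ¬ v k ≈ 0# → ¬ v l ≈ v k → ¬ μ ≈ 0# →
        ∃₂ λ p q → p ℕ.+ q ≡ n × charPoly (ι p) (ι q) μ ≈ 0#
      nonconstant-eigenvector k l a≉0 b≉a μ≉0 =
        let vieta-s , vieta-e = vieta b≉a
            p , q , p+q≡n , sums = sum-twoValued v (two-values μ≉0 vieta-s vieta-e)
            s≈ = sums id id
            Q≈ = sums (λ x → x * x) (λ x≈y → *-cong x≈y x≈y)
        in p , q , p+q≡n , conclude (ι p) (ι q) (trans vieta-s s≈) (form-vieta s≈ Q≈ vieta-e)
        where
        conclude : ∀ p q → μ * (v k + v l) ≈ p * v k + q * v l → form p q μ (v k) (v l) ≈ 0# → charPoly p q μ ≈ 0#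
        conclude p q vieta-s form≈0 = [ (λ a²≈0 → contradiction (square-zero a²≈0) a≉0) , id ]′
          (zero-divisor-free (proj₁ (charPoly-root {p} {q} {μ} {v k} {v l} vieta-s form≈0)))

      nonconstant-or-constant : NonZero v → ¬ μ ≈ 0# → CompleteCases n z
      nonconstant-or-constant v≉0 μ≉0 = go (nonZero-entry v v≉0)
        where
        go : (∃ λ k → ¬ v k ≈ 0#) → CompleteCases n z
        go (k , a≉0) with Finₚ.all? (λ i → v i ≟ v k)
        ... | yes v≈a = constant (constant-eigenvector k a≉0 v≈a)
        ... | no v≉a  =
          let l , b≉a = Finₚ.¬∀⟶∃¬ n _ (λ i → v i ≟ v k) v≉a
              p , q , p+q≡n , charPoly≈0 = nonconstant-eigenvector k l a≉0 b≉a μ≉0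
          in root p q p+q≡n charPoly≈0

    complete-cases : ∀ {z} → IsCompleteEigenvalue n z → CompleteCases n z
    complete-cases {z = z} (v , v≉0 , eigen) with (1# + - z) ≟ 0#
    ... | yes μ≈0 = one (sym (x-y≈0⇒x≈y _ _ μ≈0))
    ... | no μ≉0  = nonconstant-or-constant v eigen v≉0 μ≉0

    -- Matching the two spectra of order 3 within a multiple of n.

    private
      infix 4 _≤ʳ_
      _≤ʳ_ = ℝ._≤_

    ‖-‖ : ∀ z w → ‖ z + - w ‖ ≤ʳ ‖ z ‖ ℝ.+ ‖ w ‖
    ‖-‖ z w = ≤-trans (‖‖-+ z (- w)) (+-mono-≤ (inj₂ ℝ.refl) (inj₂ (‖‖-neg w)))

    -- With n = 1 + t, absorbing an additive constant into a multiple of n becomes nonnegativity of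
    -- a polynomial in t.
    1≤ι : ∀ n → 1 ℕ.≤ n → ∃ λ t → ℝ.0# ≤ʳ t × ℝ.ι n ℝ.≈ ℝ.ι 1 ℝ.+ t
    1≤ι (suc n) _ = ℝ.ι n , 0≤ι n , ℝ.×-homo-+ ℝ.1# 1 n

    -- All estimates aim at a common 7n; the open balls need strictness, bought with one more n
    -- since n ≥ 1.
    7n<8n : ∀ {n x} → 1 ℕ.≤ n → x ≤ʳ ℝ.ι 7 ℝ.* ℝ.ι n → x ℝ.< ℝ.ι 8 ℝ.* ℝ.ι n
    7n<8n {suc n} _ x≤ = ℝ.≤-<-trans x≤ (ℝ.<-resp₂ ℝ.refl
      (ℝ.solve 1 (λ n → ℝ.con (+ 7) ℝ.:* n ℝ.:+ n ℝ.:= ℝ.con (+ 8) ℝ.:* n) ℝ.refl (ℝ.ι (suc n)))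
      (ℝ.x<x+p _ (0<ι n)))

    double-≤ : ∀ {x y} → ℝ.ι 2 ℝ.* x ≤ʳ ℝ.ι 2 ℝ.* y → x ≤ʳ y
    double-≤ = *-cancelˡ-≤ (0<ι 1)

    2*½D : ∀ p q → ℝ.ι 2 ℝ.* (½ ℝ.* D p q) ℝ.≈ D p q
    2*½D p q = ℝ.trans (ℝ.solve 2 (λ h d → ℝ.con (+ 2) ℝ.:* (h ℝ.:* d) ℝ.:= h ℝ.:* ℝ.con (+ 2) ℝ.:* d) ℝ.refl ½ (D p q))
      (ℝ.trans (ℝ.*-congʳ ½*2≈1) (ℝ.*-identityˡ _))

    0≤7ι : ∀ n → ℝ.0# ≤ʳ ℝ.ι 7 ℝ.* ℝ.ι n
    0≤7ι n = ℝ.*-nonneg (0≤ι 7) (0≤ι n)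

    full-near-zero : ∀ p q {w} → w ≈ center p q → D p q ≤ʳ ℝ.ι 8 ℝ.* ℝ.ι (p ℕ.+ q) →
                     ‖ 0# + - w ‖ ≤ʳ ℝ.ι 7 ℝ.* ℝ.ι (p ℕ.+ q)
    full-near-zero p q {w} w≈ D≤ = ≤-trans
      (inj₂ (ℝ.trans (‖‖-cong (+-identityˡ _)) (ℝ.trans (‖‖-neg w) (ℝ.trans (‖‖-cong w≈) (‖center‖ p q)))))
      (double-≤ (≤-trans (inj₂ (2*½D p q)) (≤-trans D≤
        (≤-slack (ℝ.ι 6 ℝ.* ℝ.ι (p ℕ.+ q)) (ℝ.*-nonneg (0≤ι 6) (0≤ι (p ℕ.+ q)))
          (ℝ.solve 1 (λ n → ℝ.con (+ 2) ℝ.:* (ℝ.con (+ 7) ℝ.:* n) ℝ.:= ℝ.con (+ 8) ℝ.:* n ℝ.:+ ℝ.con (+ 6) ℝ.:* n)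
            ℝ.refl (ℝ.ι (p ℕ.+ q)))))))

    -- With e = (D - 8n)/2 the cubic has a root -y, where y = D/2 - u and 0 ≤ u ≤ 3n. The eigenvalue
    -- 1 + y differs from D/2 by 1 - u, of norm at most 1 + 3n.
    full-near-root : ∀ p q {w} → 1 ℕ.≤ p ℕ.+ q → w ≈ center p q → ℝ.ι 8 ℝ.* ℝ.ι (p ℕ.+ q) ≤ʳ D p q →
      ∃ λ z → IsCompleteEigenvalue (p ℕ.+ q) z × ‖ z + - w ‖ ≤ʳ ℝ.ι 7 ℝ.* ℝ.ι (p ℕ.+ q)
    full-near-root p q {w} 1≤n w≈ 8n≤D =
      let c , 0≤c , D≈8n+c = ≤-gap 8n≤D
          e = ½ ℝ.* c
          0≤e = ℝ.*-nonneg 0≤½ 0≤c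
          t , 0≤t , n≈1+t = 1≤ι (p ℕ.+ q) 1≤n
          n≈ = ℝ.×-homo-+ ℝ.1# p q
          2e≈c : ℝ.ι 2 ℝ.* e ℝ.≈ c
          2e≈c = ℝ.trans (ℝ.solve 2 (λ h d → ℝ.con (+ 2) ℝ.:* (h ℝ.:* d) ℝ.:= h ℝ.:* ℝ.con (+ 2) ℝ.:* d) ℝ.refl ½ c)
                   (ℝ.trans (ℝ.*-congʳ ½*2≈1) (ℝ.*-identityˡ c))
          D≈ : D p q ℝ.≈ ℝ.ι 2 ℝ.* (ℝ.ι 4 ℝ.* (ℝ.ι p ℝ.+ ℝ.ι q) ℝ.+ e)
          D≈ = ℝ.trans D≈8n+c (ℝ.trans (ℝ.+-cong (ℝ.*-congˡ n≈) (ℝ.sym 2e≈c))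
                 (ℝ.solve 2 (λ n e → ℝ.con (+ 8) ℝ.:* n ℝ.:+ ℝ.con (+ 2) ℝ.:* e
                    ℝ.:= ℝ.con (+ 2) ℝ.:* (ℝ.con (+ 4) ℝ.:* n ℝ.:+ e)) ℝ.refl (ℝ.ι p ℝ.+ ℝ.ι q) e))
          y , lo≤y , y≤hi , root≈0 = charPoly-negative-root (0≤ι p) (0≤ι q) e 0≤e D≈
          0<n+e = ℝ.<-≤-trans (ℝ.<-resp₂ ℝ.refl (ℝ.trans (ℝ.sym n≈1+t) n≈) (ℝ.<-≤-trans (0<ι 0) (ℝ.x≤x+p _ 0≤t))) (ℝ.x≤x+p _ 0≤e)
      in _ , negative-root-complete p q 1≤n (ℝ.<-≤-trans 0<n+e lo≤y) root≈0
           , near y e lo≤y y≤hi (2-cancel (ℝ.trans (2*½D p q) D≈))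
      where
      2-cancel : ∀ {x y} → ℝ.ι 2 ℝ.* x ℝ.≈ ℝ.ι 2 ℝ.* y → x ℝ.≈ y
      2-cancel eq = ≤-antisym (double-≤ (inj₂ eq)) (double-≤ (inj₂ (ℝ.sym eq)))
      near : ∀ y e → ℝ.ι p ℝ.+ ℝ.ι q ℝ.+ e ≤ʳ y → y ≤ʳ ℝ.ι 4 ℝ.* (ℝ.ι p ℝ.+ ℝ.ι q) ℝ.+ e →
             ½ ℝ.* D p q ℝ.≈ ℝ.ι 4 ℝ.* (ℝ.ι p ℝ.+ ℝ.ι q) ℝ.+ e →
             ‖ 1# + - fromℝ (ℝ.- y) + - w ‖ ≤ʳ ℝ.ι 7 ℝ.* ℝ.ι (p ℕ.+ q)
      near y e lo≤y y≤hi ½D≈ =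
        let u , 0≤u , hi≈y+u = ≤-gap y≤hi
            r , 0≤r , y≈lo+r = ≤-gap lo≤y
            t , 0≤t , n≈1+t = 1≤ι (p ℕ.+ q) 1≤n
            n = ℝ.ι p ℝ.+ ℝ.ι q
            ñ≈ = ℝ.×-homo-+ ℝ.1# p q
            3n≈r+u : ℝ.ι 3 ℝ.* n ℝ.≈ r ℝ.+ u
            3n≈r+u = ℝ.trans (ℝ.solve 2 (λ n e → ℝ.con (+ 3) ℝ.:* n ℝ.:= ℝ.con (+ 4) ℝ.:* n ℝ.:+ e ℝ.:+ ℝ.:- (n ℝ.:+ e)) ℝ.refl n e)
              (ℝ.trans (ℝ.+-congʳ (ℝ.trans hi≈y+u (ℝ.+-congʳ y≈lo+r)))
                (ℝ.solve 3 (λ l r u → l ℝ.:+ r ℝ.:+ u ℝ.:+ ℝ.:- l ℝ.:= r ℝ.:+ u) ℝ.refl (n ℝ.+ e) r u))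
            z-w≈ : 1# + - fromℝ (ℝ.- y) + - w ≈ 1# + - fromℝ u
            z-w≈ = begin
              1# + - fromℝ (ℝ.- y) + - w
                ≈⟨ +-cong (+-congˡ (trans (-‿cong (fromℝ-neg y)) (-‿involutive _)))
                          (-‿cong (trans w≈ (trans (fromℝ-cong (ℝ.trans ½D≈ hi≈y+u)) (fromℝ-+ y u)))) ⟩
              1# + fromℝ y + - (fromℝ y + fromℝ u)
                ≈⟨ solve 3 (λ o y u → o :+ y :+ :- (y :+ u) := o :+ :- u) refl 1# (fromℝ y) (fromℝ u) ⟩
              1# + - fromℝ u ∎
        in ≤-trans (inj₂ (‖‖-cong z-w≈)) (≤-trans (‖-‖ 1# (fromℝ u)) (≤-trans
             (inj₂ (ℝ.+-cong ‖1‖ (‖fromℝ‖ 0≤u)))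
             (≤-slack (r ℝ.+ ℝ.ι 3 ℝ.* t ℝ.+ ℝ.ι 3 ℝ.* ℝ.ι 1 ℝ.+ t) (ℝ.+-nonneg (ℝ.+-nonneg (ℝ.+-nonneg 0≤r (ℝ.*-nonneg (0≤ι 3) 0≤t)) (ℝ.*-nonneg (0≤ι 3) (0≤ι 1))) 0≤t)
               (ℝ.trans (ℝ.solve 1 (λ n → ℝ.con (+ 7) ℝ.:* n ℝ.:= ℝ.con (+ 3) ℝ.:* n ℝ.:+ ℝ.con (+ 4) ℝ.:* n) ℝ.refl (ℝ.ι (p ℕ.+ q)))
                 (ℝ.trans (ℝ.+-cong (ℝ.trans (ℝ.*-congˡ ñ≈) 3n≈r+u) (ℝ.*-congˡ n≈1+t))
                   (ℝ.solve 3 (λ r u t → r ℝ.:+ u ℝ.:+ ℝ.con (+ 4) ℝ.:* (ℝ.con (+ 1) ℝ.:+ t)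
                      ℝ.:= ℝ.con (+ 1) ℝ.:+ u ℝ.:+ (r ℝ.:+ ℝ.con (+ 3) ℝ.:* t ℝ.:+ ℝ.con (+ 3) ℝ.:* ℝ.con (+ 1) ℝ.:+ t)) ℝ.refl r u t))))))

    full-near-complete : ∀ {n w} → 1 ℕ.≤ n → IsFullEigenvalue n w →
      ∃ λ z → IsCompleteEigenvalue n z × ‖ z + - w ‖ ℝ.< ℝ.ι 8 ℝ.* ℝ.ι n
    full-near-complete {n} {w} 1≤n full with full-cases full
    ... | inj₁ w≈0 = 0# , zero-complete 1≤n ,
      7n<8n 1≤n (≤-trans (inj₂ (‖0‖≈0 (trans (+-identityˡ _) (trans (-‿cong w≈0) (RingProperties.-0#≈0# ring))))) (0≤7ι n))
    ... | inj₂ (p , q , ≡.refl , w≈) with compare (D p q) (ℝ.ι 8 ℝ.* ℝ.ι (p ℕ.+ q))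
    ... | tri< D<8n _ _ = 0# , zero-complete 1≤n , 7n<8n 1≤n (full-near-zero p q w≈ (inj₁ D<8n))
    ... | tri≈ _ D≈8n _ = 0# , zero-complete 1≤n , 7n<8n 1≤n (full-near-zero p q w≈ (inj₂ D≈8n))
    ... | tri> _ _ 8n<D = let z , complete , near = full-near-root p q 1≤n w≈ (inj₁ 8n<D) in z , complete , 7n<8n 1≤n near

    balanced : ∀ n → ∃₂ λ p q → p ℕ.+ q ≡ n × (q ≡ p ⊎ q ≡ suc p)
    balanced zero          = 0 , 0 , ≡.refl , inj₁ ≡.refl
    balanced (suc zero)    = 0 , 1 , ≡.refl , inj₂ ≡.refl
    balanced (suc (suc n)) =
      let p , q , p+q≡n , q≡ = balanced n
      in suc p , suc q , ≡.cong suc (≡.trans (ℕₚ.+-suc p q) (≡.cong suc p+q≡n)) , Sum.map (≡.cong suc) (≡.cong suc) q≡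

    D-balanced : ∀ p q → q ≡ p ⊎ q ≡ suc p → D p q ≤ʳ ℝ.ι 1
    D-balanced p .p       (inj₁ ≡.refl) = ≤-slack (ℝ.ι 1) (0≤ι 1)
      (ℝ.solve 1 (λ p → ℝ.con (+ 1) ℝ.:= (p ℝ.:+ ℝ.:- p) ℝ.:* (p ℝ.:+ ℝ.:- p) ℝ.:+ ℝ.con (+ 1)) ℝ.refl (ℝ.ι p))
    D-balanced p .(suc p) (inj₂ ≡.refl) = inj₂ (ℝ.trans
      (ℝ.*-cong diff diff)
      (ℝ.solve 1 (λ p → (p ℝ.:+ ℝ.:- (ℝ.con (+ 1) ℝ.:+ p)) ℝ.:* (p ℝ.:+ ℝ.:- (ℝ.con (+ 1) ℝ.:+ p)) ℝ.:= ℝ.con (+ 1)) ℝ.refl (ℝ.ι p)))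
      where diff = ℝ.+-congˡ {ℝ.ι p} (ℝ.-‿cong (ℝ.×-homo-+ ℝ.1# 1 p))

    -- Balancing the signs makes D equal to 0 or 1. The resulting point is the partner of every
    -- small eigenvalue of the complete hypergraph, and also witnesses that M is inhabited.
    small-full : ∀ n → 1 ℕ.≤ n → ∃ λ z → IsFullEigenvalue n z × ℝ.ι 2 ℝ.* ‖ z ‖ ≤ʳ ℝ.ι 1
    small-full n 1≤n with balanced n
    ... | p , q , ≡.refl , q≡ = center p q , center-full p q 1≤n ,
      ≤-trans (inj₂ (ℝ.trans (ℝ.*-congˡ (‖center‖ p q)) (2*½D p q))) (D-balanced p q q≡)

    small-near : ∀ {n c w} → 1 ℕ.≤ n → ℝ.ι 2 ℝ.* ‖ c ‖ ≤ʳ ℝ.ι 1 → ‖ w ‖ ≤ʳ ℝ.ι 1 ℝ.+ ℝ.ι n →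
                 ‖ c + - w ‖ ≤ʳ ℝ.ι 7 ℝ.* ℝ.ι n
    small-near {n} {c} {w} 1≤n 2c≤1 w≤ =
      let t , 0≤t , n≈1+t = 1≤ι n 1≤n
      in double-≤ (≤-trans (*-monoʳ-≤ (0≤ι 2) (‖-‖ c w)) (≤-trans
           (inj₂ (ℝ.solve 2 (λ c w → ℝ.con (+ 2) ℝ.:* (c ℝ.:+ w) ℝ.:= ℝ.con (+ 2) ℝ.:* c ℝ.:+ ℝ.con (+ 2) ℝ.:* w) ℝ.refl ‖ c ‖ ‖ w ‖))
           (≤-trans (+-mono-≤ 2c≤1 (*-monoʳ-≤ (0≤ι 2) w≤))
             (≤-slack (ℝ.ι 9 ℝ.+ ℝ.ι 12 ℝ.* t) (ℝ.+-nonneg (0≤ι 9) (ℝ.*-nonneg (0≤ι 12) 0≤t))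
               (ℝ.trans (ℝ.*-congˡ (ℝ.*-congˡ n≈1+t)) (ℝ.trans
                 (ℝ.solve 1 (λ t → ℝ.con (+ 2) ℝ.:* (ℝ.con (+ 7) ℝ.:* (ℝ.con (+ 1) ℝ.:+ t))
                   ℝ.:= ℝ.con (+ 1) ℝ.:+ ℝ.con (+ 2) ℝ.:* (ℝ.con (+ 1) ℝ.:+ (ℝ.con (+ 1) ℝ.:+ t)) ℝ.:+ (ℝ.con (+ 9) ℝ.:+ ℝ.con (+ 12) ℝ.:* t)) ℝ.refl t)
                 (ℝ.+-congʳ (ℝ.+-congˡ (ℝ.*-congˡ (ℝ.+-congˡ (ℝ.sym n≈1+t)))))))))))

    ‖2*‖ : ∀ z → ‖ ι 2 * z ‖ ℝ.≈ ℝ.ι 2 ℝ.* ‖ z ‖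
    ‖2*‖ z = ℝ.trans (‖‖-* _ _) (ℝ.*-congʳ (‖ι‖ 2))

    -- Twice w is (n - 1)(n - 2) and twice `center n 0` is n²; they differ by 3n - 2.
    constant-near : ∀ n {w} → 1 ℕ.≤ n → ι 2 * w ≈ ι n * ι n + - (ι 3 * ι n) + ι 2 →
                    ‖ center n 0 + - w ‖ ≤ʳ ℝ.ι 7 ℝ.* ℝ.ι n
    constant-near n {w} 1≤n 2w≈ =
      let t , 0≤t , n≈1+t = 1≤ι n 1≤n
      in double-≤ (≤-trans (inj₂ (ℝ.trans (ℝ.sym (‖2*‖ _)) (‖‖-cong 2[c-w]≈))) (≤-trans (‖-‖ (ι 3 * ι n) (ι 2))
           (≤-trans (inj₂ (ℝ.+-cong (ℝ.trans (‖‖-* _ _) (ℝ.*-cong (‖ι‖ 3) (‖ι‖ n))) (‖ι‖ 2)))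
             (≤-slack (ℝ.ι 9 ℝ.+ ℝ.ι 11 ℝ.* t) (ℝ.+-nonneg (0≤ι 9) (ℝ.*-nonneg (0≤ι 11) 0≤t))
               (ℝ.trans (ℝ.*-congˡ (ℝ.*-congˡ n≈1+t)) (ℝ.trans
                 (ℝ.solve 1 (λ t → ℝ.con (+ 2) ℝ.:* (ℝ.con (+ 7) ℝ.:* (ℝ.con (+ 1) ℝ.:+ t))
                   ℝ.:= ℝ.con (+ 3) ℝ.:* (ℝ.con (+ 1) ℝ.:+ t) ℝ.:+ ℝ.con (+ 2) ℝ.:+ (ℝ.con (+ 9) ℝ.:+ ℝ.con (+ 11) ℝ.:* t)) ℝ.refl t)
                 (ℝ.+-congʳ (ℝ.+-congʳ (ℝ.*-congˡ (ℝ.sym n≈1+t))))))))))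
      where
      2[c-w]≈ : ι 2 * (center n 0 + - w) ≈ ι 3 * ι n + - ι 2
      2[c-w]≈ = begin
        ι 2 * (center n 0 + - w)            ≈⟨ solve 2 (λ c w → con (+ 2) :* (c :+ :- w) := con (+ 2) :* c :+ :- (con (+ 2) :* w)) refl _ w ⟩
        ι 2 * center n 0 + - (ι 2 * w)      ≈⟨ +-cong (double (center≈ n 0)) (-‿cong 2w≈) ⟩
        (ι n + - 0#) * (ι n + - 0#) + - (ι n * ι n + - (ι 3 * ι n) + ι 2)
          ≈⟨ solve 1 (λ n → (n :+ :- con (+ 0)) :* (n :+ :- con (+ 0)) :+ :- (n :* n :+ :- (con (+ 3) :* n) :+ con (+ 2))
               := con (+ 3) :* n :+ :- con (+ 2)) refl (ι n) ⟩
        ι 3 * ι n + - ι 2 ∎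

    -- With X = 2μ + D - 3n, twice the error is X + 3n - 2. The cubic reads μ²X = pq(n - 6μ), so
    -- `root-bound` gives 4‖X‖ ≤ 7n, and eight times the error is at most 7n + 12n + 8, below 56n.
    large-root-near : ∀ p q {w} → 1 ℕ.≤ p ℕ.+ q → charPoly (ι p) (ι q) (1# + - w) ≈ 0# →
      ℝ.ι (p ℕ.+ q) ≤ʳ ‖ 1# + - w ‖ → ‖ center p q + - w ‖ ≤ʳ ℝ.ι 7 ℝ.* ℝ.ι (p ℕ.+ q)
    large-root-near p q {w} 1≤n charPoly≈0 n≤m =
      let t , 0≤t , n≈1+t = 1≤ι (p ℕ.+ q) 1≤n
          n = ℝ.ι (p ℕ.+ q)
          0<n = ℝ.<-resp₂ ℝ.refl (ℝ.sym n≈1+t) (ℝ.<-≤-trans (0<ι 0) (ℝ.x≤x+p _ 0≤t))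
          4x≤7n = ≤-trans (root-bound (0≤ι p) (0≤ι q) (ℝ.<-≤-trans 0<n n≤m) (≤-trans (inj₂ (ℝ.sym n≈)) n≤m) norms ‖Y‖≤)
                          (inj₂ (ℝ.*-congˡ (ℝ.sym n≈)))
      in *-cancelˡ-≤ (0<ι 7) (≤-trans
           (inj₂ (ℝ.trans (ℝ.solve 1 (λ x → ℝ.con (+ 8) ℝ.:* x ℝ.:= ℝ.con (+ 4) ℝ.:* (ℝ.con (+ 2) ℝ.:* x)) ℝ.refl _)
                          (ℝ.*-congˡ (ℝ.trans (ℝ.sym (‖2*‖ _)) (‖‖-cong 2[c-w]≈)))))
           (≤-trans (*-monoʳ-≤ (0≤ι 4) (≤-trans (‖-‖ _ (ι 2)) (+-mono-≤ (‖‖-+ X (ι 3 * ι (p ℕ.+ q))) (inj₂ ℝ.refl))))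
           (≤-trans (inj₂ (ℝ.trans (ℝ.*-congˡ (ℝ.+-cong (ℝ.+-congˡ (ℝ.trans (‖‖-* _ _) (ℝ.*-cong (‖ι‖ 3) (‖ι‖ (p ℕ.+ q))))) (‖ι‖ 2)))
                (ℝ.solve 2 (λ x n → ℝ.con (+ 4) ℝ.:* (x ℝ.:+ ℝ.con (+ 3) ℝ.:* n ℝ.:+ ℝ.con (+ 2))
                   ℝ.:= ℝ.con (+ 4) ℝ.:* x ℝ.:+ (ℝ.con (+ 12) ℝ.:* n ℝ.:+ ℝ.con (+ 8))) ℝ.refl ‖ X ‖ n)))
           (≤-trans (+-mono-≤ 4x≤7n (inj₂ ℝ.refl))
             (≤-slack (ℝ.ι 29 ℝ.+ ℝ.ι 37 ℝ.* t) (ℝ.+-nonneg (0≤ι 29) (ℝ.*-nonneg (0≤ι 37) 0≤t))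
               (ℝ.trans (ℝ.*-congˡ (ℝ.*-congˡ n≈1+t)) (ℝ.trans
                 (ℝ.solve 1 (λ t → let n = ℝ.con (+ 1) ℝ.:+ t in ℝ.con (+ 8) ℝ.:* (ℝ.con (+ 7) ℝ.:* n)
                   ℝ.:= ℝ.con (+ 7) ℝ.:* n ℝ.:+ (ℝ.con (+ 12) ℝ.:* n ℝ.:+ ℝ.con (+ 8)) ℝ.:+ (ℝ.con (+ 29) ℝ.:+ ℝ.con (+ 37) ℝ.:* t)) ℝ.refl t)
                 (ℝ.+-congʳ (ℝ.+-cong (ℝ.*-congˡ (ℝ.sym n≈1+t)) (ℝ.+-congʳ (ℝ.*-congˡ (ℝ.sym n≈1+t))))))))))))
      where
      μ X Y : Carrier
      μ = 1# + - w
      X = ι 2 * μ + (ι p + - ι q) * (ι p + - ι q) + - (ι 3 * (ι p + ι q))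
      Y = (ι p + ι q) + - (ι 6 * μ)
      n≈ : ℝ.ι (p ℕ.+ q) ℝ.≈ ℝ.ι p ℝ.+ ℝ.ι q
      n≈ = ℝ.×-homo-+ ℝ.1# p q
      norms : ‖ μ ‖ ℝ.* ‖ μ ‖ ℝ.* ‖ X ‖ ℝ.≈ ℝ.ι p ℝ.* ℝ.ι q ℝ.* ‖ Y ‖
      norms = ℝ.trans (ℝ.sym (ℝ.trans (‖‖-* _ _) (ℝ.*-congʳ (‖‖-* μ μ)))) (ℝ.trans
        (‖‖-cong (x-y≈0⇒x≈y (μ * μ * X) (ι p * ι q * Y) (trans (sym (charPoly-expand (ι p) (ι q) μ)) charPoly≈0)))
        (ℝ.trans (‖‖-* _ _) (ℝ.*-congʳ (ℝ.trans (‖‖-* _ _) (ℝ.*-cong (‖ι‖ p) (‖ι‖ q))))))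
      ‖Y‖≤ : ‖ Y ‖ ≤ʳ (ℝ.ι p ℝ.+ ℝ.ι q) ℝ.+ ℝ.ι 6 ℝ.* ‖ μ ‖
      ‖Y‖≤ = ≤-trans (‖-‖ _ _) (+-mono-≤ (≤-trans (‖‖-+ _ _) (inj₂ (ℝ.+-cong (‖ι‖ p) (‖ι‖ q))))
                                         (inj₂ (ℝ.trans (‖‖-* _ _) (ℝ.*-congʳ (‖ι‖ 6)))))
      2[c-w]≈ : ι 2 * (center p q + - w) ≈ X + ι 3 * ι (p ℕ.+ q) + - ι 2
      2[c-w]≈ = begin
        ι 2 * (center p q + - w)        ≈⟨ solve 2 (λ c w → con (+ 2) :* (c :+ :- w) := con (+ 2) :* c :+ :- (con (+ 2) :* w)) refl _ w ⟩
        ι 2 * center p q + - (ι 2 * w)  ≈⟨ +-congʳ (double (center≈ p q)) ⟩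
        D̂ + - (ι 2 * w)
          ≈⟨ solve 5 (λ o p q w D → D :+ :- (con (+ 2) :* w) := con (+ 2) :* (o :+ :- w) :+ D :+ :- (con (+ 3) :* (p :+ q))
                 :+ con (+ 3) :* (p :+ q) :+ :- (con (+ 2) :* o)) refl 1# (ι p) (ι q) w D̂ ⟩
        X + ι 3 * (ι p + ι q) + - (ι 2 * 1#)
          ≈⟨ +-cong (+-congˡ (*-congˡ (sym (×-homo-+ 1# p q)))) (-‿cong (*-identityʳ _)) ⟩
        X + ι 3 * ι (p ℕ.+ q) + - ι 2 ∎
        where D̂ = (ι p + - ι q) * (ι p + - ι q)

    complete-near-full : ∀ {n w} → 1 ℕ.≤ n → IsCompleteEigenvalue n w →
      ∃ λ z → IsFullEigenvalue n z × ‖ z + - w ‖ ℝ.< ℝ.ι 8 ℝ.* ℝ.ι n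
    complete-near-full {n} {w} 1≤n complete = go (complete-cases complete)
      where
      small : ‖ w ‖ ≤ʳ ℝ.ι 1 ℝ.+ ℝ.ι n → ∃ λ z → IsFullEigenvalue n z × ‖ z + - w ‖ ℝ.< ℝ.ι 8 ℝ.* ℝ.ι n
      small w≤ = let c , full , c≤ = small-full n 1≤n in c , full , 7n<8n 1≤n (small-near 1≤n c≤ w≤)

      small-root : ‖ 1# + - w ‖ ≤ʳ ℝ.ι n → ‖ w ‖ ≤ʳ ℝ.ι 1 ℝ.+ ℝ.ι n
      small-root m≤n = ≤-trans (inj₂ (‖‖-cong (solve 2 (λ o w → w := o :+ :- (o :+ :- w)) refl 1# w)))
        (≤-trans (‖-‖ 1# (1# + - w)) (+-mono-≤ (inj₂ ‖1‖) m≤n))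

      go : CompleteCases n w → ∃ λ z → IsFullEigenvalue n z × ‖ z + - w ‖ ℝ.< ℝ.ι 8 ℝ.* ℝ.ι n
      go (one w≈1) = small (≤-trans (inj₂ (ℝ.trans (‖‖-cong w≈1) ‖1‖)) (ℝ.x≤x+p _ (0≤ι n)))
      go (constant 2w≈) = center n 0 ,
        ≡.subst (λ k → IsFullEigenvalue k (center n 0)) (ℕₚ.+-identityʳ n) (center-full n 0 (ℕₚ.≤-trans 1≤n (ℕₚ.m≤m+n n 0))) ,
        7n<8n 1≤n (constant-near n 1≤n 2w≈)
      go (root p q ≡.refl charPoly≈0) with compare (ℝ.ι n) ‖ 1# + - w ‖
      ... | tri< n<m _ _ = center p q , center-full p q 1≤n , 7n<8n 1≤n (large-root-near p q 1≤n charPoly≈0 (inj₁ n<m))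
      ... | tri≈ _ n≈m _ = small (small-root (inj₂ (ℝ.sym n≈m)))
      ... | tri> _ _ m<n = small (small-root (inj₁ m<n))

-- Index sets and the support of the adjacency hypermatrix.

open import Data.Nat.Base using (_≤_) renaming (_^_ to _^ℕ_)

card-∪-∉ : ∀ {n} {i : Fin n} {p : Subset n} → i ∉ p → card (⁅ i ⁆ ∪ p) ≡ suc (card p)
card-∪-∉ {i = zero}  {inside  ∷ p} i∉p = contradiction here i∉p
card-∪-∉ {i = zero}  {outside ∷ p} i∉p = ≡.cong (suc ∘ card) (Subsetₚ.∪-identityˡ p)
card-∪-∉ {i = suc i} {inside  ∷ p} i∉p = ≡.cong suc (card-∪-∉ (i∉p ∘ there))
card-∪-∉ {i = suc i} {outside ∷ p} i∉p = card-∪-∉ (i∉p ∘ there)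

card-∪-∈ : ∀ {n} {i : Fin n} {p : Subset n} → i ∈ p → card (⁅ i ⁆ ∪ p) ≡ card p
card-∪-∈ {p = inside ∷ p} here = ≡.cong (suc ∘ card) (Subsetₚ.∪-identityˡ p)
card-∪-∈ {p = inside  ∷ p} (there i∈p) = ≡.cong suc (card-∪-∈ i∈p)
card-∪-∈ {p = outside ∷ p} (there i∈p) = card-∪-∈ i∈p

card-∪-≤ : ∀ {n} (i : Fin n) (p : Subset n) → card (⁅ i ⁆ ∪ p) ≤ suc (card p)
card-∪-≤ i p with i Subsetₚ.∈? p
... | yes i∈p = ℕₚ.≤-trans (ℕₚ.≤-reflexive (card-∪-∈ i∈p)) (ℕₚ.n≤1+n _)
... | no i∉p  = ℕₚ.≤-reflexive (card-∪-∉ i∉p)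

module _ {n : ℕ} where

  -- The innermost layer of `indexSet`, whose union of a list ends in the empty set.
  ⁅_⁆¹ : Fin n → Subset n
  ⁅ i ⁆¹ = ⁅ i ⁆ ∪ ∅

  card-⁅⁆¹ : ∀ i → card ⁅ i ⁆¹ ≡ 1
  card-⁅⁆¹ i = ≡.trans (≡.cong card (Subsetₚ.∪-identityʳ ⁅ i ⁆)) (Subsetₚ.∣⁅x⁆∣≡1 i)

  ∉⁅⁆¹ : ∀ {i j} → ¬ j ≡ i → i ∉ ⁅ j ⁆¹
  ∉⁅⁆¹ {i} {j} j≢i i∈ = [ j≢i ∘ ≡.sym ∘ Subsetₚ.x∈⁅y⁆⇒x≡y j , Subsetₚ.∉⊥ ]′ (Subsetₚ.x∈p∪q⁻ ⁅ j ⁆ ∅ i∈)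

  ∈⁅⁆¹ : ∀ i → i ∈ ⁅ i ⁆¹
  ∈⁅⁆¹ i = Subsetₚ.x∈p∪q⁺ (inj₁ (Subsetₚ.x∈⁅x⁆ i))

  -- Convertible with the test that `adjacency` performs on the complete hypergraph; likewise
  -- `distinct₃`.
  distinct₂ : Fin n → Fin n → Bool
  distinct₂ i j = does (card (⁅ i ⁆ ∪ ⁅ j ⁆¹) ℕₚ.≟ 2)

  distinct₂-on : ∀ {i j} → ¬ j ≡ i → distinct₂ i j ≡ true
  distinct₂-on {i} {j} j≢i = dec-true (_ ℕₚ.≟ 2) (≡.trans (card-∪-∉ (∉⁅⁆¹ j≢i)) (≡.cong suc (card-⁅⁆¹ j)))

  distinct₂-off : ∀ i → distinct₂ i i ≡ false
  distinct₂-off i = dec-false (card (⁅ i ⁆ ∪ ⁅ i ⁆¹) ℕₚ.≟ 2) λ eq →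
    contradiction (≡.trans (≡.sym eq) (≡.trans (card-∪-∈ (∈⁅⁆¹ i)) (card-⁅⁆¹ i))) λ ()

  distinct₃ : Fin n → Fin n → Fin n → Bool
  distinct₃ i j l = does (card (⁅ i ⁆ ∪ (⁅ j ⁆ ∪ ⁅ l ⁆¹)) ℕₚ.≟ 3)

  distinct₃-on : ∀ {i j l} → ¬ j ≡ i → ¬ l ≡ i → ¬ l ≡ j → distinct₃ i j l ≡ true
  distinct₃-on {i} {j} {l} j≢i l≢i l≢j = dec-true (_ ℕₚ.≟ 3)
    (≡.trans (card-∪-∉ i∉) (≡.cong suc (≡.trans (card-∪-∉ (∉⁅⁆¹ l≢j)) (≡.cong suc (card-⁅⁆¹ l)))))
    where
    i∉ : i ∉ ⁅ j ⁆ ∪ ⁅ l ⁆¹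
    i∉ i∈ = [ j≢i ∘ ≡.sym ∘ Subsetₚ.x∈⁅y⁆⇒x≡y j , ∉⁅⁆¹ l≢i ]′ (Subsetₚ.x∈p∪q⁻ ⁅ j ⁆ ⁅ l ⁆¹ i∈)

  card≤2⇒off : ∀ i j l → card (⁅ i ⁆ ∪ (⁅ j ⁆ ∪ ⁅ l ⁆¹)) ≤ 2 → distinct₃ i j l ≡ false
  card≤2⇒off i j l ≤2 = dec-false (card (⁅ i ⁆ ∪ (⁅ j ⁆ ∪ ⁅ l ⁆¹)) ℕₚ.≟ 3) λ eq →
    ℕₚ.<-irrefl ≡.refl (ℕₚ.≤-trans (ℕₚ.≤-reflexive (≡.sym eq)) ≤2)

  card-pair≤2 : ∀ j l → card (⁅ j ⁆ ∪ ⁅ l ⁆¹) ≤ 2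
  card-pair≤2 j l = ℕₚ.≤-trans (card-∪-≤ j ⁅ l ⁆¹) (ℕₚ.≤-reflexive (≡.cong suc (card-⁅⁆¹ l)))

  distinct₃-off₁ : ∀ i l → distinct₃ i i l ≡ false
  distinct₃-off₁ i l = card≤2⇒off i i l
    (ℕₚ.≤-trans (ℕₚ.≤-reflexive (card-∪-∈ (Subsetₚ.x∈p∪q⁺ (inj₁ (Subsetₚ.x∈⁅x⁆ i))))) (card-pair≤2 i l))

  distinct₃-off₂ : ∀ i j → distinct₃ i j i ≡ false
  distinct₃-off₂ i j = card≤2⇒off i j i
    (ℕₚ.≤-trans (ℕₚ.≤-reflexive (card-∪-∈ (Subsetₚ.x∈p∪q⁺ {p = ⁅ j ⁆} (inj₂ (∈⁅⁆¹ i))))) (card-pair≤2 j i))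

  distinct₃-off₃ : ∀ i j → distinct₃ i j j ≡ false
  distinct₃-off₃ i j = card≤2⇒off i j j
    (ℕₚ.≤-trans (card-∪-≤ i _) (ℕ.s≤s (ℕₚ.≤-reflexive (≡.trans (card-∪-∈ (∈⁅⁆¹ j)) (card-⁅⁆¹ j)))))

-- From a bound C n^m on the distance to o(n^(m+1)).

module Distance (ℝ : CompleteOrderedField) where
  open Spectra ℝ hiding (_*_; _+_; _≈_; -_; 0#; 1#; sum; _^_; _·_)
  open ComplexNumbers ℝ hiding (_≟_)
  open RealOrder ℝ
  private
    module ℝ where
      open CompleteOrderedField ℝ public
      open CommutativeRing commutativeRing public
        using (refl; sym; trans; *-congˡ; +-identityʳ; *-comm; *-assoc; *-identityʳ)
      open TwoValues commutativeRing public using (ι)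
      open SemiringMult (CommutativeRing.semiring commutativeRing) public using (×-homo-+; ×1-homo-*)
    module ℂₛ = Spectra ℝ
  open ℝ using (ι)

  ι-mono-≤ : ∀ {m n} → m ≤ n → ι m ℝ.≤ ι n
  ι-mono-≤ {m} {n} m≤n = ≤-slack (ι (n ℕ.∸ m)) (0≤ι (n ℕ.∸ m))
    (ℝ.trans (≡.subst (λ k → ι n ℝ.≈ ι k) (≡.sym (ℕₚ.m+[n∸m]≡n m≤n)) ℝ.refl) (ℝ.×-homo-+ ℝ.1# m (n ℕ.∸ m)))

  ∣fromℝ∣ : ∀ {x} → ℝ.0# ℝ.≤ x → ∣ fromℝ x ∣ ℝ.≈ x
  ∣fromℝ∣ 0≤x = ≡.subst (ℝ._≈ _) (‖‖≡∣∣ _) (‖fromℝ‖ 0≤x)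

  ι⁻¹*ι : ∀ n → ι (suc n) ℝ.⁻¹ ℝ.* ι (suc n) ℝ.≈ ℝ.1#
  ι⁻¹*ι n = ℝ.trans (ℝ.*-comm _ _) (ℝ.*-inverseʳ _ λ ι≈0 → irrefl (ℝ.sym ι≈0) (0<ι n))

  ½ : Real
  ½ = ι 2 ℝ.⁻¹

  ½*2≈1 : ½ ℝ.* ι 2 ℝ.≈ ℝ.1#
  ½*2≈1 = ι⁻¹*ι 1

  inverse-one : 1/ 1 ! ℂₛ.≈ ℂₛ.1#
  inverse-one = ℝ.trans (ℝ.sym (ℝ.trans (ℝ.*-congˡ (ℝ.+-identityʳ ℝ.1#)) (ℝ.*-identityʳ _))) (ι⁻¹*ι 0) , ℝ.refl

  -- Returns from the opaque norm to `∣_∣`, and rewrites n as `n ^ℕ 1`, which computes to n · 1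
  -- rather than to n.
  near : ∀ n {z w r} → ‖ z ℂₛ.+ ℂₛ.- w ‖ ℝ.< r ℝ.* ι n → Ball (r ℝ.* ι (n ^ℕ 1)) z w
  near n = ≡.subst (λ k → _ ℝ.< _ ℝ.* ι k) (≡.sym (ℕₚ.*-identityʳ n)) ∘ ≡.subst (ℝ._< _) (‖‖≡∣∣ _)

  module _ (M L : ℕ → ℂ → Set) (C m : ℕ)
    (M-inhabited : ∀ n → 1 ≤ n → ∃ (M n))
    (M-near-L : ∀ n → 1 ≤ n → M n ⊆ 𝒩 (ι C ℝ.* ι (n ^ℕ m)) (L n))
    (L-near-M : ∀ n → 1 ≤ n → L n ⊆ 𝒩 (ι C ℝ.* ι (n ^ℕ m)) (M n)) where

    -- Any element of M has a neighbour at distance below r, which forces r > 0. Were both sets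
    -- empty, every r would be admissible and no infimum would exist; this is the purpose of
    -- `M-inhabited`.
    0-lowerBound : ∀ n → 1 ≤ n → ℝ.LowerBound (λ r → M n ⊆ 𝒩 r (L n) × L n ⊆ 𝒩 r (M n)) ℝ.0#
    0-lowerBound n 1≤n (M⊆ , _) =
      let _ , Mz = M-inhabited n 1≤n
          w , _ , ∣w-z∣<r = M⊆ Mz
      in ≤-trans (≡.subst (ℝ.0# ℝ.≤_) (‖‖≡∣∣ _) 0≤‖ _ ‖) (inj₁ ∣w-z∣<r)

    distance : ∀ n → 1 ≤ n → ∃ (IsMinkowskiDistance (M n) (L n))
    distance n 1≤n = infimum (λ r → M n ⊆ 𝒩 r (L n) × L n ⊆ 𝒩 r (M n))
      (ι C ℝ.* ι (n ^ℕ m) , (λ {_} → M-near-L n 1≤n) , (λ {_} → L-near-M n 1≤n)) (ℝ.0# , 0-lowerBound n 1≤n)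

    δ : ℕ → Real
    -- A placeholder: in dimension 0 there is no nonzero vector, so both spectra are empty and no
    -- distance exists.
    δ zero    = ℝ.0#
    δ (suc n) = proj₁ (distance (suc n) (ℕ.s≤s ℕ.z≤n))

    δ-isDistance : ∀ n → 1 ≤ n → IsMinkowskiDistance (M n) (L n) (δ n)
    δ-isDistance (suc n) _ = proj₂ (distance (suc n) (ℕ.s≤s ℕ.z≤n))

    0≤δ : ∀ n → 1 ≤ n → ℝ.0# ℝ.≤ δ n
    0≤δ n 1≤n = ℝ.IsInfimum.greatest (δ-isDistance n 1≤n) (0-lowerBound n 1≤n)

    δ≤ : ∀ n → 1 ≤ n → δ n ℝ.≤ ι C ℝ.* ι (n ^ℕ m)
    δ≤ n 1≤n = ℝ.IsInfimum.lower (δ-isDistance n 1≤n) ((λ {_} → M-near-L n 1≤n) , (λ {_} → L-near-M n 1≤n))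

    δ=o : δ =o (λ n → fromℕℝ (n ^ℕ suc m))
    δ=o ε 0<ε =
      -- C + 1 replaces C because `divide` takes a positive dividend. Any n > c then satisfies C ≤
      -- εn, hence C n^m ≤ ε n^(m+1).
      let c , _ , εc≈C+1 = ℝ.divide (ι (suc C)) 0<ε (0<ι C)
          N , c<N = ℝ.archimedean c
      in suc N , λ n N<n →
        let 1≤n = ℕₚ.≤-trans (ℕ.s≤s ℕ.z≤n) N<n
            C≤εn = ≤-trans (ι-mono-≤ (ℕₚ.n≤1+n C)) (≤-trans (inj₂ (ℝ.sym εc≈C+1))
                     (*-monoʳ-≤ (inj₁ 0<ε) (≤-trans (inj₁ c<N) (ι-mono-≤ (ℕₚ.<⇒≤ N<n)))))
        in ≤-trans (inj₂ (∣fromℝ∣ (0≤δ n 1≤n))) (≤-trans (δ≤ n 1≤n) (≤-trans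
             (ℝ.≤-resp₂ (ℝ.*-comm _ _) (ℝ.*-comm _ _) (*-monoʳ-≤ (0≤ι (n ^ℕ m)) C≤εn))
             (inj₂ (ℝ.trans (ℝ.*-assoc _ _ _) (ℝ.*-congˡ
               (ℝ.trans (ℝ.sym (ℝ.×1-homo-* n (n ^ℕ m))) (ℝ.sym (∣fromℝ∣ (0≤ι (n ^ℕ suc m))))))))))

    minkowskiDistance-o : ∃ λ (δ : ℕ → Real) →
      (∀ n → 1 ≤ n → IsMinkowskiDistance (M n) (L n) (δ n)) × δ =o (λ n → fromℕℝ (n ^ℕ suc m))
    minkowskiDistance-o = δ , δ-isDistance , δ=o

theorem3 : (ℝ : CompleteOrderedField) → let open Spectra ℝ in
    (k-1 : ℕ) → let k = suc k-1 in k ≡ 2 ⊎ k ≡ 3 →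
    let L : ℕ → ℂ → Set
        L n = IsEigenvalue (adjacency (complete k n))
        M : ℕ → ℂ → Set
        M n = IsEigenvalue (1/ k-1 ! · 𝕁 k n)
    in ∃ λ (δ : ℕ → Real) →
         (∀ n → 1 ≤ n → IsMinkowskiDistance (M n) (L n) (δ n)) ×
         δ =o (λ n → fromℕℝ (n ^ℕ k-1))
theorem3 ℝ .1 (inj₁ ≡.refl) = minkowskiDistance-o M L 2 0
    (λ n 1≤n → _ , n-full₂ inverse-one 1≤n)
    -- Using `near` at 1 fits the exponent 0, as `n ^ℕ 0` and `1 ^ℕ 1` both compute to 1.
    (λ n 1≤n {w} full → _ , full⇒complete₂ inverse-one distinct₂ distinct₂-on distinct₂-off full , near 1 (subtract-one-near w))
    (λ n 1≤n {w} complete → _ , complete⇒full₂ inverse-one distinct₂ distinct₂-on distinct₂-off complete , near 1 (add-one-near w))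
  where
  open Spectra ℝ using (ℂ; IsEigenvalue; 1/_!; _·_; 𝕁; adjacency; complete)
  open Distance ℝ
  open ComplexNumbers ℝ
  open EigenvalueGeometry ℝ ℂ-normedAlgebra
  L M : ℕ → ℂ → Set
  L n = IsEigenvalue (adjacency (complete 2 n))
  M n = IsEigenvalue (1/ 1 ! · 𝕁 2 n)
theorem3 ℝ .2 (inj₂ ≡.refl) = minkowskiDistance-o M L 8 1
    (λ n 1≤n → let z , full , _ = small-full ½ ½*2≈1 n 1≤n in z , full⇒eigenvalue₃ ½ ½*2≈1 full)
    (λ n 1≤n {w} full →
      let z , complete , ‖z-w‖<8n = full-near-complete ½ ½*2≈1 1≤n (eigenvalue₃⇒full ½ ½*2≈1 full)
      in z , complete⇒eigenvalue₃ ½ ½*2≈1 distinct₃ distinct₃-on distinct₃-off₁ distinct₃-off₂ distinct₃-off₃ complete , near n ‖z-w‖<8n)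
    (λ n 1≤n {w} complete →
      let z , full , ‖z-w‖<8n = complete-near-full ½ ½*2≈1 1≤n
            (eigenvalue₃⇒complete ½ ½*2≈1 distinct₃ distinct₃-on distinct₃-off₁ distinct₃-off₂ distinct₃-off₃ complete)
      in z , full⇒eigenvalue₃ ½ ½*2≈1 full , near n ‖z-w‖<8n)
  where
  open Spectra ℝ using (ℂ; IsEigenvalue; 1/_!; _·_; 𝕁; adjacency; complete)
  open Distance ℝ
  open ComplexNumbers ℝ
  open EigenvalueGeometry ℝ ℂ-normedAlgebra
  L M : ℕ → ℂ → Set
  L n = IsEigenvalue (adjacency (complete 3 n))
  M n = IsEigenvalue (1/ 2 ! · 𝕁 3 n)
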